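{- Let $q$ be a prime power. For every integer $h\ge 2$ we have $n_q(\lfloor 2.5h\rfloor,h;2)\ge q^h+2$.
   Context: All dimensions are vector-space dimensions; a hyperplane of $\mathbb{F}_q^r$ is an $(r-1)$-dimensional subspace. A projective $h-(n,r,s)_q$ system is a multiset of $n$ subspaces of $\mathbb{F}_q^r$, each of dimension at most $h$, such that each hyperplane contains at most $s$ of these subspaces (counted with multiplicity) and some hyperplane contains exactly $s$ of them. $n_q(r,h;s)$ denotes the maximum $n$ such that a projective $h-(n,r,s)_q$ system exists. -}

module Defs where

open import Algebra.Apartness.Bundles using (HeytingField; HeytingCommutativeRing)
open import Algebra.Bundles using (CommutativeRing)
open import Data.Fin.Base using (Fin)
open import Data.Fin.Subset using (_∈_; ∣_∣)
open import Data.Nat.Base using (ℕ; suc; _^_; _≤_)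
open import Data.Nat.Primality using (Prime)
open import Data.Product.Base using (∃-syntax; _×_)
open import Data.Vec.Functional using (Vector; zipWith; map)
open import Function.Bundles using (Inverse; _⇔_)
open import Level using (Level; _⊔_) renaming (suc to lsuc)
open import Relation.Binary.PropositionalEquality using (_≡_)
import Algebra.Properties.Monoid.Sum as Sum
import Data.Vec.Functional.Relation.Binary.Equality.Setoid as VecEquality
import Relation.Binary.PropositionalEquality as ≡
import Relation.Unary as Unary

IsPrimePower : ℕ → Set
IsPrimePower q = ∃[ p ] ∃[ k ] Prime p × 1 ≤ k × q ≡ p ^ k

IsMaximum : ∀ {a} → (ℕ → Set a) → ℕ → Set a
IsMaximum P m = P m × (∀ n → P n → n ≤ m)

-- The library's fields are Heyting fields. One with finitely many elements has
-- decidable equality, so its apartness is just inequality and it is a field in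
-- the usual sense; 0 ≈ 1 is excluded because apartness is irreflexive.
module _ {c ℓ₁ ℓ₂ : Level} (F : HeytingField c ℓ₁ ℓ₂) where

  open HeytingField F using (Carrier; _≈_; _+_; _*_; 0#; heytingCommutativeRing)

  private
    ring : CommutativeRing c ℓ₁
    ring = HeytingCommutativeRing.commutativeRing heytingCommutativeRing

  open CommutativeRing ring using (setoid; +-monoid)
  open Sum +-monoid using (sum)
  open VecEquality setoid using (_≋_)

  HasOrder : ℕ → Set (c ⊔ ℓ₁)
  HasOrder q = Inverse setoid (≡.setoid (Fin q))

  linComb : ∀ {r d} → Vector Carrier d → Vector (Vector Carrier r) d → Vector Carrier r
  linComb a b i = sum (λ j → a j * b j i)

  -- The predicate lives at level c ⊔ ℓ₁, which is the level of the span of a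
  -- finite family of vectors.
  record Subspace (r : ℕ) : Set (lsuc (c ⊔ ℓ₁)) where
    field
      Member   : Unary.Pred (Vector Carrier r) (c ⊔ ℓ₁)
      resp     : ∀ {v w} → v ≋ w → Member v → Member w
      0-closed : Member (λ _ → 0#)
      +-closed : ∀ {v w} → Member v → Member w → Member (zipWith _+_ v w)
      *-closed : ∀ a {v} → Member v → Member (map (a *_) v)

  open Subspace public

  _⊑_ : ∀ {r} → Subspace r → Subspace r → Set (c ⊔ ℓ₁)
  U ⊑ W = Member U Unary.⊆ Member W

  LinearlyIndependent : ∀ {r d} → Vector (Vector Carrier r) d → Set (c ⊔ ℓ₁)
  LinearlyIndependent b = ∀ a → linComb a b ≋ (λ _ → 0#) → ∀ j → a j ≈ 0#

  record IsBasis {r d} (U : Subspace r) (b : Vector (Vector Carrier r) d) : Set (c ⊔ ℓ₁) where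
    field
      members     : ∀ j → Member U (b j)
      independent : LinearlyIndependent b
      spanning    : ∀ v → Member U v → ∃[ a ] v ≋ linComb a b

  HasDim : ∀ {r} → Subspace r → ℕ → Set (c ⊔ ℓ₁)
  HasDim {r} U d = ∃[ b ] IsBasis {r} {d} U b

  IsHyperplane : ∀ {r} → Subspace r → Set (c ⊔ ℓ₁)
  IsHyperplane {r} H = ∃[ d ] suc d ≡ r × HasDim H d

  -- A multiset of n subspaces is a family indexed by Fin n, so counting indices
  -- counts members with multiplicity.
  ContainsExactly : ∀ {r n} → Subspace r → Vector (Subspace r) n → ℕ → Set (c ⊔ ℓ₁)
  ContainsExactly {n = n} H U m =
    ∃[ K ] (∀ i → (i ∈ K) ⇔ (U i ⊑ H)) × ∣_∣ {n} K ≡ m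

  record IsProjectiveSystem (h r s : ℕ) {n : ℕ} (U : Vector (Subspace r) n)
                            : Set (lsuc (c ⊔ ℓ₁)) where
    field
      dim≤h    : ∀ i → ∃[ d ] d ≤ h × HasDim (U i) d
      at-most  : ∀ H → IsHyperplane H → ∃[ m ] m ≤ s × ContainsExactly H U m
      attained : ∃[ H ] IsHyperplane H × ContainsExactly H U s

  ProjectiveSystemExists : (h n r s : ℕ) → Set (lsuc (c ⊔ ℓ₁))
  ProjectiveSystemExists h n r s =
    ∃[ U ] IsProjectiveSystem h r s {n} U

  -- N = n_q(r , h ; s).  A relation, because the maximum need not exist for all
  -- r, h and s.
  IsMaxSize : (r h s N : ℕ) → Set (lsuc (c ⊔ ℓ₁))
  IsMaxSize r h s = IsMaximum (λ n → ProjectiveSystemExists h n r s)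

{-# OPTIONS --safe #-}
module Submission where

-- A functional killing three of the subspaces U_a = {(y, a y, π(a² y)) : y ∈ K}, a ∈ K = F_{q^h}, in
-- K × K × F^⌊h/2⌋ vanishes by the Vandermonde argument, for any surjection π : K → F^⌊h/2⌋. With π on only
-- half the dimension there is room for two more members 0 × T × F^⌊h/2⌋ and 0 × T′ × F^⌊h/2⌋ where T + T′ = K.
-- This gives q^h + 2 subspaces, no three in a hyperplane; any two lie in one because 2h < ⌊5h/2⌋.
-- The maximum exists since the number of members is bounded and existence of a system is a finite search.
--
-- F_{q^h} is obtained from R = F[X]/(X^(q^h - 1) - 1), where every element satisfies y^(q^h) = y. By degree,
-- e = ∏_{1 ≤ d < h} (X^(q^d) - X) is nonzero in R, so some residue field of R keeps e ≠ 0. There X has h distinct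
-- conjugates, whence 1, X, …, X^(h-1) are independent, and all elements are roots of Y^(q^h) - Y, whence they span.

-- The 2.5 comes from a trade-off. If the third block has dimension k, a member 0 × T × F^k of
-- dimension at most h needs dim T ≤ h - k. A functional killing it has no quadratic part, so
-- against two of the U_a only a two-point argument remains. The two extra members and a single U_a
-- must also force the middle part to vanish, which needs T + T′ = K, hence 2(h - k) ≥ h. So k =
-- ⌊h/2⌋ is the largest choice. The Vandermonde argument is run as divided differences: it divides
-- by differences of points only, never by 2, and so covers every characteristic. No maximal ideal
-- is chosen for the residue field: for a suitable multiple v of e the ideal Ann(v) is prime and
-- misses e, and R/Ann(v) is the field. Since R acts on sequences, passing to R/Ann(v) only replaces
-- the sequence by its image under v; the elements stay the same expressions. Membership in a
-- `Subspace` is an arbitrary predicate, so systems themselves cannot be enumerated; the finite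
-- search runs over generators and functionals.

open import Defs
open import Algebra.Apartness.Bundles using (HeytingField; HeytingCommutativeRing)
open import Algebra.Bundles using (CommutativeMonoid; CommutativeRing)
open import Data.Fin.Base
  using (Fin; zero; suc; toℕ; fromℕ; fromℕ<; inject₁; inject≤; opposite; punchIn; punchOut; splitAt; join;
         _↑ˡ_; _↑ʳ_; combine; funToFin; finToFun; _<_)
open import Data.Fin.Permutation using (Permutation; permutation; _⟨$⟩ʳ_)
open import Data.Fin.Properties
  using (_≟_; _<?_; any?; all?; pigeonhole; funToFin-finToFin; finToFun-funToFin; combine-monoˡ-<; toℕ-combine;
         toℕ<n; toℕ-fromℕ; toℕ-fromℕ<; toℕ-inject₁; toℕ-inject≤; toℕ-injective; fromℕ<-cong; fromℕ<-toℕ;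
         opposite-prop; opposite-involutive; punchInᵢ≢i; punchIn-punchOut; join-splitAt)
open import Data.Fin.Subset using (Subset; _∈_; ∣_∣; inside; outside)
open import Data.Nat.Base using (ℕ; zero; suc; _≤_; _∸_; _!; z≤n; s≤s)
open import Data.Nat.Combinatorics using (_C_; nCn≡1; nCk≡n!/k![n-k]!; k![n∸k]!∣n!)
open import Data.Nat.Divisibility
  using (_∣_; _∣?_; divides; ∣⇒≤; ∣1⇒≡1; m∣m*n; n∣m*n; ∣m∣n⇒∣m+n; ∣m+n∣m⇒∣n; ∣-refl)
open import Data.Nat.DivMod
  using (_%_; _/_; m≡m%n+[m/n]*n; m%n<n; m/n*n≡m; m*n/n≡m; m/n*n≤m; /-monoˡ-≤; +-distrib-/-∣ʳ)
open import Data.Nat.Primality using (Prime; euclidsLemma; ¬prime[0]; ¬prime[1])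
open import Data.Product.Base using (∃-syntax; ∃₂; _×_; _,_; proj₁; proj₂)
open import Data.Sum.Base as Sum using (_⊎_; inj₁; inj₂)
open import Data.Vec.Base using (here; there)
open import Data.Vec.Functional
  using (Vector; []; _∷_; _++_; tail; take; drop; map; zipWith; insertAt; removeAt)
open import Data.Vec.Functional.Properties using (insertAt-lookup; insertAt-punchIn; lookup-++ˡ; lookup-++ʳ)
open import Function.Base using (_∘_)
open import Function.Bundles using (Inverse; _⇔_; mk⇔; Equivalence)
open import Level using (Level; _⊔_; Lift; lift)
open import Relation.Binary.Bundles using (Setoid)
open import Relation.Binary.Definitions using (Decidable)
open import Relation.Binary.PropositionalEquality
  using (_≡_; _≢_; refl; sym; trans; cong; cong₂; subst; subst₂; module ≡-Reasoning)
open import Relation.Nullary using (¬_; Dec; yes; no; contradiction)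
open import Relation.Nullary.Decidable using (map′; decidable-stable; ¬?; _×-dec_; _→-dec_)
import Algebra.Properties.CommutativeMonoid.Sum as CommutativeMonoidSum
import Algebra.Properties.CommutativeSemigroup as CommutativeSemigroupProperties
import Algebra.Properties.CommutativeSemiring.Binomial as Binomial
import Algebra.Properties.CommutativeSemiring.Exp as Exp
import Algebra.Properties.Group as GroupProperties
import Algebra.Properties.Ring as RingProperties
import Algebra.Properties.Semiring.Mult as Mult
import Algebra.Properties.Semiring.Sum as SemiringSum
import Algebra.Solver.Ring.NaturalCoefficients.Default as SemiringSolver
import Data.Nat.Base as ℕ
import Data.Nat.Properties as ℕ
import Data.Vec.Base as Vec
import Data.Vec.Functional.Relation.Binary.Equality.Setoid as VecEquality
import Relation.Binary.PropositionalEquality as ≡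
import Relation.Binary.Reasoning.Setoid as SetoidReasoning
import Relation.Unary as Unary

-- Finite sets

Finite : ∀ {a ℓ} → Setoid a ℓ → ℕ → Set _
Finite S N = Inverse S (≡.setoid (Fin N))

module _ {a ℓ} (S : Setoid a ℓ) {N} (S↔Fin : Finite S N) where
  open Setoid S renaming (Carrier to A; refl to ≈-refl; sym to ≈-sym; trans to ≈-trans)
  open Inverse S↔Fin

  finite⇒≟ : Decidable _≈_
  finite⇒≟ x y = map′
    (λ eq → ≈-trans (≈-sym (strictlyInverseʳ x)) (≈-trans (from-cong eq) (strictlyInverseʳ y)))
    to-cong (to x ≟ to y)

  finite⇒any? : ∀ {p} {P : A → Set p} → (∀ {x y} → x ≈ y → P x → P y) → Unary.Decidable P → Dec (∃[ x ] P x)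
  finite⇒any? resp P? = map′ (λ (i , Pi) → from i , Pi)
    (λ (x , Px) → to x , resp (≈-sym (strictlyInverseʳ x)) Px) (any? (P? ∘ from))

  finite⇒all? : ∀ {p} {P : A → Set p} → (∀ {x y} → x ≈ y → P x → P y) → Unary.Decidable P → Dec (∀ x → P x)
  finite⇒all? resp P? = map′ (λ ∀P x → resp (strictlyInverseʳ x) (∀P (to x))) (λ ∀P → ∀P ∘ from) (all? (P? ∘ from))

  open VecEquality S using (_≋_; ≋-setoid)

  finite-power : ∀ m → Finite (≋-setoid m) (N ℕ.^ m)
  finite-power m = record
    { to = encode
    ; from = decode
    ; to-cong = encode-cong
    ; from-cong = λ { refl _ → ≈-refl }
    ; inverse = (λ { {i} v≈ → trans (encode-cong v≈) (encode-decode i) })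
              , (λ { {v} refl j → decode-encode v j }) }
    where
    encode = λ v → funToFin (to ∘ v)
    decode = λ i → from ∘ finToFun i
    funToFin-cong : ∀ {m} {f g : Fin m → Fin N} → (∀ i → f i ≡ g i) → funToFin f ≡ funToFin g
    funToFin-cong {zero} f≗g = refl
    funToFin-cong {suc m} f≗g = cong₂ combine (f≗g zero) (funToFin-cong (f≗g ∘ suc))
    encode-cong : ∀ {v w} → v ≋ w → encode v ≡ encode w
    encode-cong v≋w = funToFin-cong (λ i → to-cong (v≋w i))
    encode-decode : ∀ i → encode (decode i) ≡ i
    encode-decode i = trans (funToFin-cong {m} (λ j → strictlyInverseˡ (finToFun i j))) (funToFin-finToFin {m} i)
    decode-encode : ∀ v j → decode (encode v) j ≈ v j
    decode-encode v j = ≈-trans (from-cong (finToFun-funToFin (to ∘ v) j)) (strictlyInverseʳ (v j))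

one-∈ : ∀ {n} {K : Subset n} → 1 ≤ ∣ K ∣ → ∃[ i ] i ∈ K
one-∈ {K = inside Vec.∷ K}  _   = zero , here
one-∈ {K = outside Vec.∷ K} 1≤K with i , i∈K ← one-∈ 1≤K = suc i , there i∈K

two-∈ : ∀ {n} {K : Subset n} → 2 ≤ ∣ K ∣ → ∃₂ λ i j → i < j × i ∈ K × j ∈ K
two-∈ {K = inside Vec.∷ K}  (s≤s 1≤K) with i , i∈K ← one-∈ 1≤K = zero , suc i , ℕ.z<s , here , there i∈K
two-∈ {K = outside Vec.∷ K} 2≤K with i , j , i<j , i∈K , j∈K ← two-∈ 2≤K =
  suc i , suc j , ℕ.s<s i<j , there i∈K , there j∈K

three-∈ : ∀ {n} {K : Subset n} → 3 ≤ ∣ K ∣ →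
  ∃[ i ] ∃[ j ] ∃[ l ] i < j × j < l × i ∈ K × j ∈ K × l ∈ K
three-∈ {K = inside Vec.∷ K} (s≤s 2≤K) with i , j , i<j , i∈K , j∈K ← two-∈ 2≤K =
  zero , suc i , suc j , ℕ.z<s , ℕ.s<s i<j , here , there i∈K , there j∈K
three-∈ {K = outside Vec.∷ K} 3≤K with i , j , l , i<j , j<l , i∈K , j∈K , l∈K ← three-∈ 3≤K =
  suc i , suc j , suc l , ℕ.s<s i<j , ℕ.s<s j<l , there i∈K , there j∈K , there l∈K

∈⇒1≤∣∣ : ∀ {n} {K : Subset n} {i} → i ∈ K → 1 ≤ ∣ K ∣
∈⇒1≤∣∣ here = s≤s z≤n
∈⇒1≤∣∣ {K = inside Vec.∷ K}  (there i∈K) = s≤s z≤n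
∈⇒1≤∣∣ {K = outside Vec.∷ K} (there i∈K) = ∈⇒1≤∣∣ i∈K

∈∈⇒2≤∣∣ : ∀ {n} {K : Subset n} {i j} → i < j → i ∈ K → j ∈ K → 2 ≤ ∣ K ∣
∈∈⇒2≤∣∣ _ here (there j∈K) = s≤s (∈⇒1≤∣∣ j∈K)
∈∈⇒2≤∣∣ {K = inside Vec.∷ K}  (s≤s i<j) (there i∈K) (there j∈K) = ℕ.m≤n⇒m≤1+n (∈∈⇒2≤∣∣ i<j i∈K j∈K)
∈∈⇒2≤∣∣ {K = outside Vec.∷ K} (s≤s i<j) (there i∈K) (there j∈K) = ∈∈⇒2≤∣∣ i<j i∈K j∈K

∈∈∈⇒3≤∣∣ : ∀ {n} {K : Subset n} {i j l} → i < j → j < l → i ∈ K → j ∈ K → l ∈ K → 3 ≤ ∣ K ∣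
∈∈∈⇒3≤∣∣ _ (s≤s j<l) here (there j∈K) (there l∈K) = s≤s (∈∈⇒2≤∣∣ j<l j∈K l∈K)
∈∈∈⇒3≤∣∣ {K = inside Vec.∷ K} (s≤s i<j) (s≤s j<l) (there i∈K) (there j∈K) (there l∈K) =
  ℕ.m≤n⇒m≤1+n (∈∈∈⇒3≤∣∣ i<j j<l i∈K j∈K l∈K)
∈∈∈⇒3≤∣∣ {K = outside Vec.∷ K} (s≤s i<j) (s≤s j<l) (there i∈K) (there j∈K) (there l∈K) =
  ∈∈∈⇒3≤∣∣ i<j j<l i∈K j∈K l∈K

combine-monoʳ-< : ∀ {m n} (i : Fin m) {j k : Fin n} → j < k → combine i j < combine i k
combine-monoʳ-< i {j} {k} j<k =
  subst₂ ℕ._<_ (sym (toℕ-combine i j)) (sym (toℕ-combine i k)) (ℕ.+-monoʳ-< _ j<k)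

-- Each of suc M blocks of suc M indices contains a collision, and two blocks collide at the same value.
pigeonhole₃ : ∀ {M} (f : Fin (suc M ℕ.* suc M) → Fin M) →
  ∃[ i ] ∃[ j ] ∃[ l ] i < j × j < l × f i ≡ f j × f j ≡ f l
pigeonhole₃ {M} f =
  let b , b′ , b<b′ , same = pigeonhole (ℕ.n<1+n M) (λ b → f (combine b (proj₁ (collision b))))
      i , j , i<j , fi≡fj = collision b
  in combine b i , combine b j , combine b′ (proj₁ (collision b′)) ,
     combine-monoʳ-< b i<j , combine-monoˡ-< j _ b<b′ , fi≡fj , trans (sym fi≡fj) same
  where
  collision : ∀ b → ∃₂ λ i j → i < j × f (combine b i) ≡ f (combine b j)
  collision b = pigeonhole (ℕ.n<1+n M) (f ∘ combine b)

bounded⇒maximum : ∀ {a} {P : ℕ → Set a} → Unary.Decidable P → ∀ B → (∀ n → P n → n ≤ B) →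
  ∀ {m} → P m → ∃[ N ] IsMaximum P N × m ≤ N
-- The search descends from the bound; if it reaches 0, `m` itself is the maximum.
bounded⇒maximum P? zero bound Pm = _ , (Pm , λ n Pn → ℕ.≤-trans (bound n Pn) z≤n) , ℕ.≤-refl
bounded⇒maximum P? (suc B) bound {m} Pm with P? (suc B)
... | yes P[1+B] = suc B , (P[1+B] , bound) , bound m Pm
... | no ¬P[1+B] = bounded⇒maximum P? B
  (λ n Pn → ℕ.s≤s⁻¹ (ℕ.≤∧≢⇒< (bound n Pn) (λ { refl → ¬P[1+B] Pn }))) Pm

-- Finite fields

prime∣!⇒≤ : ∀ {p} → Prime p → ∀ k → p ∣ k ! → p ≤ k
prime∣!⇒≤ pr zero p∣1 = contradiction (subst Prime (∣1⇒≡1 p∣1) pr) ¬prime[1]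
prime∣!⇒≤ pr (suc k) p∣ with euclidsLemma (suc k) (k !) pr p∣
... | inj₁ p∣1+k = ∣⇒≤ p∣1+k
... | inj₂ p∣k!  = ℕ.m≤n⇒m≤1+n (prime∣!⇒≤ pr k p∣k!)

-- `p` divides `p !`, which is `p C k` times factorials of numbers below `p`, and it divides none of
-- those factorials.
prime∣C : ∀ {p} → Prime p → ∀ k → 0 ℕ.< k → k ℕ.< p → p ∣ p C k
prime∣C {p} pr k 0<k k<p
  with euclidsLemma (p C k) (k ℕ.! ℕ.* (p ∸ k) ℕ.!) pr p∣C*d
  where
  instance d≢0 = ℕ._!*_!≢0 k (p ∸ k)
  k≤p = ℕ.<⇒≤ k<p
  C*d≡p! : (p C k) ℕ.* (k ! ℕ.* (p ∸ k) !) ≡ p !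
  C*d≡p! = trans (cong (ℕ._* (k ! ℕ.* (p ∸ k) !)) (nCk≡n!/k![n-k]! k≤p))
                 (m/n*n≡m (k![n∸k]!∣n! k≤p))
  p∣p! : ∀ {p} → 0 ℕ.< p → p ∣ p !
  p∣p! {suc p} _ = m∣m*n (p !)
  p∣C*d = subst (p ∣_) (sym C*d≡p!) (p∣p! (ℕ.<-trans 0<k k<p))
... | inj₁ p∣C = p∣C
... | inj₂ p∣d with euclidsLemma (k !) ((p ∸ k) !) pr p∣d
...   | inj₁ p∣k! = contradiction (prime∣!⇒≤ pr k p∣k!) (ℕ.<⇒≱ k<p)
...   | inj₂ p∣!  = contradiction (prime∣!⇒≤ pr (p ∸ k) p∣!)
                      (ℕ.<⇒≱ (ℕ.∸-monoʳ-< 0<k (ℕ.<⇒≤ k<p)))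

module FiniteSums {c ℓ} (R : CommutativeRing c ℓ) where

  open CommutativeRing R hiding (zero) renaming (refl to ≈-refl; sym to ≈-sym; trans to ≈-trans)
  open SemiringSum semiring public
    using (sum; sum-cong-≋; sum-replicate-zero; sum-init-last; sum-remove; ∑-distrib-+; *-distribˡ-sum)

  sum-zero : ∀ {n} (f : Vector Carrier n) → (∀ i → f i ≈ 0#) → sum f ≈ 0#
  sum-zero {n} f f≈0 = ≈-trans (sum-cong-≋ f≈0) (sum-replicate-zero n)

  sum-select : ∀ {n} (f : Vector Carrier n) i → (∀ j → j ≢ i → f j ≈ 0#) → sum f ≈ f i
  sum-select {suc n} f i others≈0 = ≈-trans (sum-remove {i = i} f)
    (≈-trans (+-congˡ (sum-zero _ (λ j → others≈0 (punchIn i j) (punchInᵢ≢i i j)))) (+-identityʳ _))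

module Frobenius {c ℓ} (R : CommutativeRing c ℓ) where

  open CommutativeRing R hiding (zero) renaming (refl to ≈-refl; sym to ≈-sym; trans to ≈-trans)
  open Mult semiring using () renaming (_×_ to _·_)
  open Mult semiring using (×-assocˡ; ×-congʳ; ×-congˡ; ×-assoc-*; ×-homo-1)
  open FiniteSums R using (sum; sum-zero; sum-init-last)
  open Exp commutativeSemiring using (_^_; ^-congˡ; ^-assocʳ)
  open Binomial commutativeSemiring using (theorem; binomialTerm)
  open SetoidReasoning setoid

  module _ {p} (pr : Prime p) (p×1≈0 : p · 1# ≈ 0#) where

    multiple×≈0 : ∀ {n} → p ∣ n → ∀ x → n · x ≈ 0#
    multiple×≈0 {n} (divides m n≡m*p) x = begin
      n · x               ≈⟨ ×-congˡ (trans n≡m*p (ℕ.*-comm m p)) ⟩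
      (p ℕ.* m) · x       ≈⟨ ×-assocˡ x p m ⟨
      p · (m · x)         ≈⟨ ×-congʳ p (*-identityˡ _) ⟨
      p · (1# * (m · x))  ≈⟨ ×-assoc-* p 1# (m · x) ⟨
      p · 1# * (m · x)    ≈⟨ *-congʳ p×1≈0 ⟩
      0# * (m · x)        ≈⟨ zeroˡ _ ⟩
      0#                  ∎

    private
      outer-terms : ∀ n (f : Vector Carrier (suc (suc n))) →
        (∀ i → f (suc (inject₁ i)) ≈ 0#) → sum f ≈ f zero + f (fromℕ (suc n))
      outer-terms n f inner≈0 = +-congˡ (begin
        sum (tail f)                                       ≈⟨ sum-init-last (tail f) ⟩
        sum (λ i → f (suc (inject₁ i))) + f (fromℕ (suc n)) ≈⟨ +-congʳ (sum-zero _ inner≈0) ⟩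
        0# + f (fromℕ (suc n))                             ≈⟨ +-identityˡ _ ⟩
        f (fromℕ (suc n))                                  ∎)

      -- All inner binomial coefficients are multiples of `p`. The exponent is a separate `n` so
      -- that it can be matched as a successor, which gives the binomial sum distinct first and last
      -- terms.
      expand : ∀ n → n ≡ p → ∀ x y → (x + y) ^ n ≈ x ^ n + y ^ n
      expand zero    0≡p = contradiction (subst Prime (sym 0≡p) pr) ¬prime[0]
      expand (suc n) refl x y = begin
        (x + y) ^ p                              ≈⟨ theorem p x y ⟩
        sum (binomialTerm x y p)                 ≈⟨ outer-terms n (binomialTerm x y p) inner ⟩
        (p C 0) · (1# * y ^ p) + last-term         ≈⟨ +-cong first last ⟩
        y ^ p + x ^ p                            ≈⟨ +-comm _ _ ⟩
        x ^ p + y ^ p                            ∎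
        where
        last-term = binomialTerm x y p (fromℕ p)
        inner : ∀ i → binomialTerm x y p (suc (inject₁ i)) ≈ 0#
        inner i = multiple×≈0 (prime∣C pr (suc (toℕ (inject₁ i))) (s≤s z≤n)
          (s≤s (subst (ℕ._< n) (sym (toℕ-inject₁ i)) (toℕ<n i)))) _
        first : (p C 0) · (1# * y ^ p) ≈ y ^ p
        first = ≈-trans (×-homo-1 _) (*-identityˡ _)
        last : last-term ≈ x ^ p
        last rewrite toℕ-fromℕ n | nCn≡1 p | ℕ.n∸n≡0 n =
          ≈-trans (×-homo-1 _) (*-identityʳ _)

    ^p-+ : ∀ x y → (x + y) ^ p ≈ x ^ p + y ^ p
    ^p-+ = expand p refl

    ^p^k-+ : ∀ k x y → (x + y) ^ (p ℕ.^ k) ≈ x ^ (p ℕ.^ k) + y ^ (p ℕ.^ k)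
    ^p^k-+ zero x y = ≈-trans (*-identityʳ _) (≈-sym (+-cong (*-identityʳ x) (*-identityʳ y)))
    ^p^k-+ (suc k) x y = begin
      (x + y) ^ (p ℕ.* p ℕ.^ k)                ≈⟨ ^-assocʳ (x + y) p (p ℕ.^ k) ⟨
      ((x + y) ^ p) ^ (p ℕ.^ k)                ≈⟨ ^-congˡ (p ℕ.^ k) (^p-+ x y) ⟩
      (x ^ p + y ^ p) ^ (p ℕ.^ k)              ≈⟨ ^p^k-+ k (x ^ p) (y ^ p) ⟩
      (x ^ p) ^ (p ℕ.^ k) + (y ^ p) ^ (p ℕ.^ k) ≈⟨ +-cong (^-assocʳ x p _) (^-assocʳ y p _) ⟩
      x ^ (p ℕ.* p ℕ.^ k) + y ^ (p ℕ.* p ℕ.^ k) ∎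

-- Decidable equality takes the place of apartness, so that proofs may split on whether an element
-- is zero.
record IsField {c ℓ} (R : CommutativeRing c ℓ) : Set (c ⊔ ℓ) where
  open CommutativeRing R
  field
    _≈?_     : Decidable _≈_
    1≉0     : ¬ 1# ≈ 0#
    inverse : ∀ a → ¬ a ≈ 0# → ∃[ b ] a * b ≈ 1#

  *-cancel-0 : ∀ {a b} → ¬ a ≈ 0# → a * b ≈ 0# → b ≈ 0#
  *-cancel-0 {a} {b} a≉0 ab≈0 with a⁻¹ , aa⁻¹≈1 ← inverse a a≉0 = begin
    b              ≈⟨ *-identityˡ b ⟨
    1# * b         ≈⟨ *-congʳ aa⁻¹≈1 ⟨
    a * a⁻¹ * b    ≈⟨ *-congʳ (*-comm a a⁻¹) ⟩
    a⁻¹ * a * b    ≈⟨ *-assoc a⁻¹ a b ⟩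
    a⁻¹ * (a * b)  ≈⟨ *-congˡ ab≈0 ⟩
    a⁻¹ * 0#       ≈⟨ zeroʳ a⁻¹ ⟩
    0#             ∎
    where open SetoidReasoning setoid

  *-≉0 : ∀ {a b} → ¬ a ≈ 0# → ¬ b ≈ 0# → ¬ a * b ≈ 0#
  *-≉0 a≉0 b≉0 ab≈0 = b≉0 (*-cancel-0 a≉0 ab≈0)

module FiniteField {c ℓ} (F : CommutativeRing c ℓ) (isField : IsField F)
  {q} (F↔Fin : Inverse (CommutativeRing.setoid F) (≡.setoid (Fin q))) where

  open CommutativeRing F hiding (zero) renaming (refl to ≈-refl; sym to ≈-sym; trans to ≈-trans)
  open IsField isField
  open Inverse F↔Fin hiding (inverse)
  open Mult semiring using (×1-homo-*) renaming (_×_ to _·_)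
  open SemiringSum semiring using (sum; sum-cong-≋; sum-permute; ∑-distrib-+; sum-replicate)
  open Exp commutativeSemiring using (_^_; ^-congˡ)
  open GroupProperties +-group using (identityʳ-unique)
  module Π = CommutativeMonoidSum *-commutativeMonoid
  open SetoidReasoning setoid

  private
    reindex : (φ ψ : Carrier → Carrier) → (∀ {x y} → x ≈ y → φ x ≈ φ y) →
      (∀ {x y} → x ≈ y → ψ x ≈ ψ y) → (∀ x → φ (ψ x) ≈ x) → (∀ x → ψ (φ x) ≈ x) → Permutation q q
    reindex φ ψ φ-cong ψ-cong φψ ψφ = permutation (to ∘ φ ∘ from) (to ∘ ψ ∘ from)
      (λ i → trans (to-cong (≈-trans (φ-cong (strictlyInverseʳ _)) (φψ (from i)))) (strictlyInverseˡ i))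
      (λ i → trans (to-cong (≈-trans (ψ-cong (strictlyInverseʳ _)) (ψφ (from i)))) (strictlyInverseˡ i))

  -- Translating by 1 permutes F, so the sum of all elements is unchanged by adding q · 1 to it.
  q·1≈0 : q · 1# ≈ 0#
  q·1≈0 = identityʳ-unique S (q · 1#) (begin
    S + q · 1#                       ≈⟨ +-congˡ (sum-replicate q) ⟨
    S + sum {q} (λ _ → 1#)           ≈⟨ ∑-distrib-+ from (λ _ → 1#) ⟨
    sum (λ i → from i + 1#)          ≈⟨ sum-cong-≋ (λ i → strictlyInverseʳ (from i + 1#)) ⟨
    sum (λ i → from (π ⟨$⟩ʳ i))      ≈⟨ sum-permute from π ⟨
    S                                ∎)
    where
    S = sum from
    π = reindex (_+ 1#) (_- 1#) +-congʳ +-congʳ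
      (λ x → ≈-trans (+-assoc x _ _) (≈-trans (+-congˡ (-‿inverseˡ 1#)) (+-identityʳ x)))
      (λ x → ≈-trans (+-assoc x _ _) (≈-trans (+-congˡ (-‿inverseʳ 1#)) (+-identityʳ x)))

  -- `p^k · 1` is a product of `k` factors `p · 1`, and a field has no zero divisors.
  p^k·1≈0⇒p·1≈0 : ∀ p k → (p ℕ.^ k) · 1# ≈ 0# → p · 1# ≈ 0#
  p^k·1≈0⇒p·1≈0 p zero 1+0≈0 = contradiction (≈-trans (≈-sym (+-identityʳ 1#)) 1+0≈0) 1≉0
  p^k·1≈0⇒p·1≈0 p (suc k) eq with (p · 1#) ≈? 0#
  ... | yes p·1≈0 = p·1≈0
  ... | no  p·1≉0 = p^k·1≈0⇒p·1≈0 p k (*-cancel-0 p·1≉0 (≈-trans (≈-sym (×1-homo-* p (p ℕ.^ k))) eq))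

  private
    Π-≉0 : ∀ {n} (f : Vector Carrier n) → (∀ i → ¬ f i ≈ 0#) → ¬ Π.sum f ≈ 0#
    Π-≉0 {zero}  f f≉0 = 1≉0
    Π-≉0 {suc n} f f≉0 = *-≉0 (f≉0 zero) (Π-≉0 (f ∘ suc) (f≉0 ∘ suc))

    -- With the factor at 0 replaced by 1, a product over the nonzero elements becomes a product
    -- over all of `Fin q`.
    unzero : Carrier → Carrier → Carrier
    unzero x y with x ≈? 0#
    ... | yes _ = 1#
    ... | no  _ = y

    unzero-0 : ∀ {x y} → x ≈ 0# → unzero x y ≈ 1#
    unzero-0 {x} x≈0 with x ≈? 0#
    ... | yes _ = ≈-refl
    ... | no x≉0 = contradiction x≈0 x≉0

    unzero-≉0 : ∀ {x y} → ¬ x ≈ 0# → unzero x y ≈ y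
    unzero-≉0 {x} x≉0 with x ≈? 0#
    ... | yes x≈0 = contradiction x≈0 x≉0
    ... | no _ = ≈-refl

    unzero-cong : ∀ {x x′ y y′} → x ≈ x′ → y ≈ y′ → unzero x y ≈ unzero x′ y′
    unzero-cong {x} {x′} x≈x′ y≈y′ with x ≈? 0# | x′ ≈? 0#
    ... | yes _   | yes _    = ≈-refl
    ... | no  _   | no  _    = y≈y′
    ... | yes x≈0 | no x′≉0  = contradiction (≈-trans (≈-sym x≈x′) x≈0) x′≉0
    ... | no x≉0  | yes x′≈0 = contradiction (≈-trans x≈x′ x′≈0) x≉0

    unzero-self-≉0 : ∀ x → ¬ unzero x x ≈ 0#
    unzero-self-≉0 x with x ≈? 0#
    ... | yes _  = 1≉0
    ... | no x≉0 = x≉0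

    unzero-* : ∀ {a} → ¬ a ≈ 0# → ∀ x → unzero (a * x) (a * x) ≈ unzero x a * unzero x x
    unzero-* {a} a≉0 x with x ≈? 0#
    ... | yes x≈0 = ≈-trans (unzero-0 (≈-trans (*-congˡ x≈0) (zeroʳ a))) (≈-sym (*-identityˡ 1#))
    ... | no  x≉0 = unzero-≉0 (*-≉0 a≉0 x≉0)

  -- Multiplication by a ≉ 0 permutes the nonzero elements, so their product absorbs a^(q-1).
  private
    unit-power : ∀ {a} → ¬ a ≈ 0# → ∀ {n} → n ≡ q → a ^ n ≈ a
    unit-power {a} a≉0 {zero} refl = contradiction (to 0#) λ ()
    unit-power {a} a≉0 {suc n} refl = ≈-trans (*-congˡ a^n≈1) (*-identityʳ a)
      where
      a⁻¹ = proj₁ (inverse a a≉0)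
      aa⁻¹≈1 = proj₂ (inverse a a≉0)
      g : Carrier → Carrier
      g x = unzero x x
      g-cong : ∀ {x y} → x ≈ y → g x ≈ g y
      g-cong x≈y = unzero-cong x≈y x≈y
      -- `P` is the product of the nonzero elements and `D` is `a ^ (q - 1)`, each with a factor 1
      -- at zero.
      P D : Carrier
      P = Π.sum (g ∘ from)
      D = Π.sum (λ i → unzero (from i) a)
      a⁻¹a≈1 = ≈-trans (*-comm a⁻¹ a) aa⁻¹≈1
      cancel : ∀ {a b} → a * b ≈ 1# → ∀ x → a * (b * x) ≈ x
      cancel ab≈1 x = ≈-trans (≈-sym (*-assoc _ _ x)) (≈-trans (*-congʳ ab≈1) (*-identityˡ x))
      π = reindex (a *_) (a⁻¹ *_) *-congˡ *-congˡ (cancel aa⁻¹≈1) (cancel a⁻¹a≈1)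
      P≈CP : P ≈ D * P
      P≈CP = begin
        P                                               ≈⟨ Π.sum-permute (g ∘ from) π ⟩
        Π.sum (λ i → g (from (π ⟨$⟩ʳ i)))
          ≈⟨ Π.sum-cong-≋ {suc n} (λ i → g-cong (strictlyInverseʳ (a * from i))) ⟩
        Π.sum (λ i → g (a * from i))                    ≈⟨ Π.sum-cong-≋ (λ i → unzero-* a≉0 (from i)) ⟩
        Π.sum (λ i → unzero (from i) a * g (from i))    ≈⟨ Π.∑-distrib-+ (λ i → unzero (from i) a) (g ∘ from) ⟩
        D * P                                           ∎
      P⁻¹ = inverse P (Π-≉0 (g ∘ from) (λ i → unzero-self-≉0 (from i)))
      D≈1 : D ≈ 1#
      D≈1 = begin
        D                      ≈⟨ *-identityʳ D ⟨
        D * 1#                 ≈⟨ *-congˡ (proj₂ P⁻¹) ⟨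
        D * (P * proj₁ P⁻¹)    ≈⟨ *-assoc D P _ ⟨
        D * P * proj₁ P⁻¹      ≈⟨ *-congʳ P≈CP ⟨
        P * proj₁ P⁻¹          ≈⟨ proj₂ P⁻¹ ⟩
        1#                     ∎
      -- Removing the index of 0 from `D` leaves `n`, that is `q - 1`, factors equal to `a`.
      i₀ = to 0#
      from-≉0 : ∀ j → ¬ from (punchIn i₀ j) ≈ 0#
      from-≉0 j eq = punchInᵢ≢i i₀ j (trans (≡.sym (strictlyInverseˡ _)) (to-cong eq))
      a^n≈1 : a ^ n ≈ 1#
      a^n≈1 = begin
        a ^ n                                              ≈⟨ Π.sum-replicate n ⟨
        Π.sum {n} (λ _ → a)                                ≈⟨ Π.sum-cong-≋ (λ j → unzero-≉0 (from-≉0 j)) ⟨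
        Π.sum (λ j → unzero (from (punchIn i₀ j)) a) ≈⟨ *-identityˡ _ ⟨
        1# * Π.sum (λ j → unzero (from (punchIn i₀ j)) a)
          ≈⟨ *-congʳ (unzero-0 (strictlyInverseʳ 0#)) ⟨
        unzero (from i₀) a * Π.sum (λ j → unzero (from (punchIn i₀ j)) a)
          ≈⟨ Π.sum-remove {i = i₀} (λ i → unzero (from i) a) ⟨
        D                                                  ≈⟨ D≈1 ⟩
        1#                                                 ∎

  ^q≈ : ∀ a → a ^ q ≈ a
  ^q≈ a with a ≈? 0#
  ... | no  a≉0 = unit-power a≉0 refl
  ... | yes a≈0 = ≈-trans (^-congˡ q a≈0) (≈-trans (0^ (to 0#)) (≈-sym a≈0))
    where
    0^ : ∀ {n} → Fin n → 0# ^ n ≈ 0#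
    0^ {suc n} _ = zeroˡ _

2≤order : ∀ {c ℓ} (F : CommutativeRing c ℓ) → IsField F → ∀ {q} →
  Finite (CommutativeRing.setoid F) q → 2 ≤ q
2≤order F isField {zero} F↔Fin = contradiction (Inverse.to F↔Fin (CommutativeRing.0# F)) λ ()
2≤order F isField {suc zero} F↔Fin =
  contradiction (F.trans (F.sym (from-zero F.1#)) (from-zero F.0#)) (IsField.1≉0 isField)
  where
  module F = CommutativeRing F
  open Inverse F↔Fin
  from-zero : ∀ x → from zero F.≈ x
  from-zero x with to x | strictlyInverseʳ x
  ... | zero | eq = eq
2≤order F isField {suc (suc q)} F↔Fin = s≤s (s≤s z≤n)

-- Field extensions

-- Polynomial expressions in the shift operator X, acting on sequences. The expressions
-- modulo the annihilator of one sequence s form the ring F[X]/Ann(s).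
module ShiftOperators {c ℓ} (F : CommutativeRing c ℓ) where

  open CommutativeRing F hiding (zero) renaming (refl to ≈-refl; sym to ≈-sym; trans to ≈-trans)
  open CommutativeSemigroupProperties *-commutativeSemigroup using (x∙yz≈y∙xz)
  open CommutativeSemigroupProperties (CommutativeMonoid.commutativeSemigroup +-commutativeMonoid) using (interchange)
  open RingProperties ring using (-1*x≈-x)

  Seq : Set c
  Seq = ℕ → Carrier

  infix 4 _≐_
  _≐_ : Seq → Seq → Set ℓ
  s ≐ t = ∀ m → s m ≈ t m

  infixl 6 _⊕_
  infixl 7 _⊗_
  data Expr : Set c where
    con : Carrier → Expr
    X   : Expr
    _⊕_ : Expr → Expr → Expr
    _⊗_ : Expr → Expr → Expr

  shift : Seq → Seq
  shift s m = s (suc m)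

  infixr 5 _∙_
  _∙_ : Expr → Seq → Seq
  (con a ∙ s) m = a * s m
  X ∙ s         = shift s
  (p ⊕ r ∙ s) m = (p ∙ s) m + (r ∙ s) m
  p ⊗ r ∙ s     = p ∙ r ∙ s

  ∙-cong : ∀ p {s t} → s ≐ t → p ∙ s ≐ p ∙ t
  ∙-cong (con a) s≐t m = *-congˡ (s≐t m)
  ∙-cong X       s≐t m = s≐t (suc m)
  ∙-cong (p ⊕ r) s≐t m = +-cong (∙-cong p s≐t m) (∙-cong r s≐t m)
  ∙-cong (p ⊗ r) s≐t   = ∙-cong p (∙-cong r s≐t)

  ∙-+ : ∀ p s t → p ∙ (λ m → s m + t m) ≐ λ m → (p ∙ s) m + (p ∙ t) m
  ∙-+ (con a) s t m = distribˡ a (s m) (t m)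
  ∙-+ X       s t m = ≈-refl
  ∙-+ (p ⊕ r) s t m = ≈-trans (+-cong (∙-+ p s t m) (∙-+ r s t m)) (interchange _ _ _ _)
  ∙-+ (p ⊗ r) s t m = ≈-trans (∙-cong p (∙-+ r s t) m) (∙-+ p _ _ m)

  ∙-* : ∀ p a s → p ∙ (λ m → a * s m) ≐ λ m → a * (p ∙ s) m
  ∙-* (con b) a s m = x∙yz≈y∙xz b a (s m)
  ∙-* X       a s m = ≈-refl
  ∙-* (p ⊕ r) a s m = ≈-trans (+-cong (∙-* p a s m) (∙-* r a s m)) (≈-sym (distribˡ a _ _))
  ∙-* (p ⊗ r) a s m = ≈-trans (∙-cong p (∙-* r a s) m) (∙-* p a _ m)

  ∙-shift : ∀ p s → p ∙ shift s ≐ shift (p ∙ s)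
  ∙-shift (con a) s m = ≈-refl
  ∙-shift X       s m = ≈-refl
  ∙-shift (p ⊕ r) s m = +-cong (∙-shift p s m) (∙-shift r s m)
  ∙-shift (p ⊗ r) s m = ≈-trans (∙-cong p (∙-shift r s) m) (∙-shift p (r ∙ s) m)

  -- Every operator is linear and commutes with the shift, which settles `con` and `X`; sums and
  -- products follow by induction on the left operator. No normal form of expressions is involved.
  ∙-comm : ∀ p r s → p ∙ r ∙ s ≐ r ∙ p ∙ s
  ∙-comm (con a)   r s m = ≈-sym (∙-* r a s m)
  ∙-comm X         r s m = ≈-sym (∙-shift r s m)
  ∙-comm (p ⊕ p′)  r s m = ≈-trans (+-cong (∙-comm p r s m) (∙-comm p′ r s m)) (≈-sym (∙-+ r _ _ m))
  ∙-comm (p ⊗ p′)  r s m = ≈-trans (∙-cong p (∙-comm p′ r s) m) (∙-comm p r (p′ ∙ s) m)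

  -- A record, because `_∙_` computes: from the bare equation `p` and `r` could not be inferred.
  record Congruent (s : Seq) (p r : Expr) : Set ℓ where
    constructor congruent
    field at : p ∙ s ≐ r ∙ s

  open Congruent public

  quotientRing : Seq → CommutativeRing c ℓ
  quotientRing s = record
    { Carrier = Expr
    ; _≈_ = Congruent s
    ; _+_ = _⊕_
    ; _*_ = _⊗_
    ; -_ = con (- 1#) ⊗_
    ; 0# = con 0#
    ; 1# = con 1#
    ; isCommutativeRing = record
      { isRing = record
        { +-isAbelianGroup = record
          { isGroup = record
            { isMonoid = record
              { isSemigroup = record
                { isMagma = record
                  { isEquivalence = record
                    { refl = congruent λ _ → ≈-refl
                    ; sym = λ eq → congruent λ m → ≈-sym (at eq m)
                    ; trans = λ eq eq′ → congruent λ m → ≈-trans (at eq m) (at eq′ m) }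
                  ; ∙-cong = λ p≈p′ r≈r′ → congruent λ m → +-cong (at p≈p′ m) (at r≈r′ m) }
                ; assoc = λ _ _ _ → congruent λ m → +-assoc _ _ _ }
              ; identity = (λ _ → congruent λ m → ≈-trans (+-congʳ (zeroˡ _)) (+-identityˡ _))
                         , (λ _ → congruent λ m → ≈-trans (+-congˡ (zeroˡ _)) (+-identityʳ _)) }
            ; inverse =
                (λ _ → congruent λ m → ≈-trans (≈-trans (+-congʳ (-1*x≈-x _)) (-‿inverseˡ _)) (≈-sym (zeroˡ _)))
              , (λ _ → congruent λ m → ≈-trans (≈-trans (+-congˡ (-1*x≈-x _)) (-‿inverseʳ _)) (≈-sym (zeroˡ _)))
            ; ⁻¹-cong = λ p≈r → congruent λ m → *-congˡ (at p≈r m) }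
          ; comm = λ _ _ → congruent λ m → +-comm _ _ }
        ; *-cong = ⊗-cong
        ; *-assoc = λ _ _ _ → congruent λ _ → ≈-refl
        ; *-identity = (λ _ → congruent λ m → *-identityˡ _)
                     , (λ p → congruent λ m → ≈-trans (∙-* p 1# s m) (*-identityˡ _))
        ; distrib = (λ p _ _ → congruent (∙-+ p _ _)) , (λ _ _ _ → congruent λ _ → ≈-refl) }
      ; *-comm = λ p r → congruent (∙-comm p r s) } }
    where
    ⊗-cong : ∀ {p p′ r r′} → Congruent s p p′ → Congruent s r r′ → Congruent s (p ⊗ r) (p′ ⊗ r′)
    -- The congruence `p ≈ p′` is known at `s` alone, so `p` is first commuted next to `s`, replaced
    -- there, and commuted back.
    ⊗-cong {p} {p′} {r} {r′} p≈p′ r≈r′ = congruent λ m →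
      ≈-trans (∙-cong p (at r≈r′) m) (≈-trans (∙-comm p r′ s m)
        (≈-trans (∙-cong r′ (at p≈p′) m) (∙-comm r′ p′ s m)))

  -- Having leading term X^d, phrased through the action, so that products need no coefficients.
  Monic : ℕ → Expr → Set (c ⊔ ℓ)
  Monic d p = ∀ s m → (∀ j → j ℕ.< d → s (m ℕ.+ j) ≈ 0#) → (p ∙ s) m ≈ s (m ℕ.+ d)

  -- If `s` vanishes on `d + e` entries from `m` on, then `r ∙ s` vanishes on `d` entries from `m`
  -- on, since its value at `m + j` is `s (m + j + e)`. So the leading term of `p` applies to
  -- `r ∙ s`.
  monic-⊗ : ∀ {d e p r} → Monic d p → Monic e r → Monic (d ℕ.+ e) (p ⊗ r)
  monic-⊗ {d} {e} {p} {r} p-monic r-monic s m s≈0 = begin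
    (p ∙ r ∙ s) m            ≈⟨ p-monic (r ∙ s) m r∙s≈0 ⟩
    (r ∙ s) (m ℕ.+ d)        ≈⟨ r-monic s (m ℕ.+ d) (λ j j<e → s≈0′ d j (ℕ.+-monoʳ-< d j<e)) ⟩
    s (m ℕ.+ d ℕ.+ e)        ≡⟨ cong s (ℕ.+-assoc m d e) ⟩
    s (m ℕ.+ (d ℕ.+ e))      ∎
    where
    open SetoidReasoning setoid
    s≈0′ : ∀ i j → i ℕ.+ j ℕ.< d ℕ.+ e → s (m ℕ.+ i ℕ.+ j) ≈ 0#
    s≈0′ i j i+j<d+e = subst (λ l → s l ≈ 0#) (sym (ℕ.+-assoc m i j)) (s≈0 (i ℕ.+ j) i+j<d+e)
    r∙s≈0 : ∀ j → j ℕ.< d → (r ∙ s) (m ℕ.+ j) ≈ 0#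
    r∙s≈0 j j<d = ≈-trans
      (r-monic s (m ℕ.+ j) (λ i i<e → s≈0′ j i (ℕ.+-mono-< j<d i<e)))
      (s≈0′ j e (ℕ.+-monoˡ-< e j<d))

  powX : ℕ → Expr
  powX zero    = con 1#
  powX (suc n) = X ⊗ powX n

  powX-∙ : ∀ n s m → (powX n ∙ s) m ≈ s (n ℕ.+ m)
  powX-∙ zero    s m = *-identityˡ _
  powX-∙ (suc n) s m = ≈-trans (powX-∙ n s (suc m)) (reflexive (cong s (ℕ.+-suc n m)))

  -- Because `1 < n`, the entry read by `- X` is among those assumed to vanish.
  monic-powX-X : ∀ {n} → 1 ℕ.< n → Monic n (powX n ⊕ (con (- 1#) ⊗ X))
  monic-powX-X {n} 1<n s m s≈0 = begin
    (powX n ∙ s) m + - 1# * s (suc m)  ≈⟨ +-cong (powX-∙ n s m) (*-congˡ s1≈0) ⟩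
    s (n ℕ.+ m) + - 1# * 0#            ≈⟨ +-congˡ (zeroʳ _) ⟩
    s (n ℕ.+ m) + 0#                   ≈⟨ +-identityʳ _ ⟩
    s (n ℕ.+ m)                        ≡⟨ cong s (ℕ.+-comm n m) ⟩
    s (m ℕ.+ n)                        ∎
    where
    open SetoidReasoning setoid
    s1≈0 : s (suc m) ≈ 0#
    s1≈0 = subst (λ l → s l ≈ 0#) (ℕ.+-comm m 1) (s≈0 1 1<n)

  monic-1 : Monic 0 (con 1#)
  monic-1 s m _ = ≈-trans (*-identityˡ _) (reflexive (cong s (sym (ℕ.+-identityʳ m))))

  poly : ∀ {n} → Vector Carrier n → Expr
  poly {zero}  a = con 0#
  poly {suc n} a = con (a zero) ⊕ X ⊗ poly (tail a)

  Periodic : ℕ → Seq → Set ℓ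
  Periodic n s = ∀ m → s (n ℕ.+ m) ≈ s m

  periodic-∙ : ∀ {n s} → Periodic n s → ∀ p → Periodic n (p ∙ s)
  periodic-∙ per (con a) m = *-congˡ (per m)
  periodic-∙ {n} {s} per X m = ≈-trans (reflexive (cong s (sym (ℕ.+-suc n m)))) (per (suc m))
  periodic-∙ per (p ⊕ r) m = +-cong (periodic-∙ per p m) (periodic-∙ per r m)
  periodic-∙ per (p ⊗ r)   = periodic-∙ (periodic-∙ per r) p

-- Elements with prime annihilator

module PrimeElement {c ℓ} (R : CommutativeRing c ℓ) where

  open CommutativeRing R hiding (zero) renaming (refl to ≈-refl; sym to ≈-sym; trans to ≈-trans)
  open SetoidReasoning setoid
  open SemiringSolver commutativeSemiring using (solve; _:*_; _:=_)

  infix 4 _∣ᴿ_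
  _∣ᴿ_ : Carrier → Carrier → Set _
  x ∣ᴿ y = ∃[ t ] y ≈ t * x

  ∣ᴿ-trans : ∀ {x y z} → x ∣ᴿ y → y ∣ᴿ z → x ∣ᴿ z
  ∣ᴿ-trans {x} {y} {z} (t , y≈tx) (u , z≈uy) =
    u * t , ≈-trans z≈uy (≈-trans (*-congˡ y≈tx) (≈-sym (*-assoc u t x)))

  -- Greedy choice: starting from `u`, multiply by `g i` whenever the product stays nonzero. Being
  -- killed by `g i` or being a multiple of `g i` both survive later multiplications.
  select : (∀ x → Dec (x ≈ 0#)) → ∀ {N} (g : Vector Carrier N) u → ¬ u ≈ 0# →
    ∃[ v ] ¬ v ≈ 0# × u ∣ᴿ v × (∀ i → v * g i ≈ 0# ⊎ g i ∣ᴿ v)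
  select 0? {zero} g u u≉0 = u , u≉0 , (1# , ≈-sym (*-identityˡ u)) , λ ()
  select 0? {suc N} g u u≉0 with 0? (u * g zero)
  ... | yes ug≈0 with v , v≉0 , u∣ᴿv@(t , v≈tu) , split ← select 0? (tail g) u u≉0 =
    v , v≉0 , u∣ᴿv , λ { zero → inj₁ (begin
      v * g zero          ≈⟨ *-congʳ v≈tu ⟩
      t * u * g zero      ≈⟨ *-assoc t u _ ⟩
      t * (u * g zero)    ≈⟨ *-congˡ ug≈0 ⟩
      t * 0#              ≈⟨ zeroʳ t ⟩
      0#                  ∎)
    ; (suc i) → split i }
  ... | no ug≉0 with v , v≉0 , ug∣ᴿv , split ← select 0? (tail g) (u * g zero) ug≉0 =
    v , v≉0 , ∣ᴿ-trans (g zero , *-comm u (g zero)) ug∣ᴿv ,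
    λ { zero → inj₂ (∣ᴿ-trans (u , ≈-refl) ug∣ᴿv) ; (suc i) → split i }

  -- If `v` were killed by neither factor it would be a multiple of both, so its cube would be a
  -- multiple of `v * (x * y)`, which is zero.
  prime : ∀ {v} → (v * (v * v) ≈ 0# → v ≈ 0#) → ¬ v ≈ 0# →
    (∀ x → v * x ≈ 0# ⊎ x ∣ᴿ v) →
    ∀ {x y} → v * (x * y) ≈ 0# → v * x ≈ 0# ⊎ v * y ≈ 0#
  prime {v} reduced v≉0 split {x} {y} vxy≈0 with split x | split y
  ... | inj₁ vx≈0 | _ = inj₁ vx≈0
  ... | inj₂ _ | inj₁ vy≈0 = inj₂ vy≈0
  ... | inj₂ (a , v≈ax) | inj₂ (b , v≈by) = contradiction (reduced (begin
    v * (v * v)              ≈⟨ *-congˡ (*-cong v≈ax v≈by) ⟩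
    v * (a * x * (b * y))    ≈⟨ solve 5 (λ v a b x y → v :* (a :* x :* (b :* y)) := a :* b :* (v :* (x :* y)))
                                  ≈-refl v a b x y ⟩
    a * b * (v * (x * y))    ≈⟨ *-congˡ vxy≈0 ⟩
    a * b * 0#               ≈⟨ zeroʳ _ ⟩
    0#                       ∎)) v≉0

-- Division by linear factors and counting roots

module Evaluation {c ℓ} (R : CommutativeRing c ℓ) where

  open CommutativeRing R hiding (zero) renaming (refl to ≈-refl; sym to ≈-sym; trans to ≈-trans)
  open Exp commutativeSemiring using (_^_)
  open SetoidReasoning setoid

  eval : ∀ {n} → Vector Carrier n → Carrier → Carrier
  eval {zero}  a y = 0#
  eval {suc n} a y = a zero + y * eval (tail a) y

  eval-congˡ : ∀ {n} (a : Vector Carrier n) {x y} → x ≈ y → eval a x ≈ eval a y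
  eval-congˡ {zero}  a x≈y = ≈-refl
  eval-congˡ {suc n} a x≈y = +-congˡ (*-cong x≈y (eval-congˡ (tail a) x≈y))

  -- Synthetic division: the quotient of the polynomial `a` by Y - r, whose coefficients are the
  -- values at `r` of the successive tails of `a`.
  quot : ∀ {n} → Vector Carrier (suc n) → Carrier → Vector Carrier n
  quot {zero}  a r = []
  quot {suc n} a r = eval (tail a) r ∷ quot (tail a) r

  -- Division with remainder at Y = z + r. Naming the difference `z` removes all subtraction, so the
  -- semiring solver applies.
  eval-quot : ∀ {n} (a : Vector Carrier (suc n)) r z →
    eval a (z + r) ≈ z * eval (quot a r) (z + r) + eval a r
  eval-quot {zero} a r z = begin
    a zero + (z + r) * 0#           ≈⟨ +-congˡ (zeroʳ _) ⟩
    a zero + 0#                     ≈⟨ +-congˡ (zeroʳ r) ⟨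
    a zero + r * 0#                 ≈⟨ +-identityˡ _ ⟨
    0# + (a zero + r * 0#)          ≈⟨ +-congʳ (zeroʳ z) ⟨
    z * 0# + (a zero + r * 0#)      ∎
  eval-quot {suc n} a r z = ≈-trans (+-congˡ (*-congˡ (eval-quot (tail a) r z)))
    (solve 5 (λ a₀ r z G T → a₀ :+ (z :+ r) :* (z :* G :+ T) := z :* (T :+ (z :+ r) :* G) :+ (a₀ :+ r :* T))
      ≈-refl (a zero) r z (eval (quot (tail a) r) (z + r)) (eval (tail a) r))
    where open SemiringSolver commutativeSemiring using (solve; _:+_; _:*_; _:=_)

  -- The first quotient coefficient is the remainder of `tail a`, so the same hypotheses hold for
  -- the tail.
  quot-zero : ∀ {n} (a : Vector Carrier (suc n)) r →
    (∀ i → quot a r i ≈ 0#) → eval a r ≈ 0# → ∀ i → a i ≈ 0#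
  quot-zero {zero} a r _ ar≈0 zero =
    ≈-trans (≈-sym (≈-trans (+-congˡ (zeroʳ r)) (+-identityʳ _))) ar≈0
  quot-zero {suc n} a r quot≈0 ar≈0 zero = begin
    a zero                            ≈⟨ +-identityʳ _ ⟨
    a zero + 0#                       ≈⟨ +-congˡ (≈-trans (*-congˡ (quot≈0 zero)) (zeroʳ r)) ⟨
    a zero + r * eval (tail a) r      ≈⟨ ar≈0 ⟩
    0#                                ∎
  quot-zero {suc n} a r quot≈0 ar≈0 (suc i) =
    quot-zero (tail a) r (quot≈0 ∘ suc) (quot≈0 zero) i

  monomial : ∀ n → Vector Carrier (suc n)
  monomial zero    = 1# ∷ []
  monomial (suc n) = 0# ∷ monomial n

  eval-monomial : ∀ n y → eval (monomial n) y ≈ y ^ n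
  eval-monomial zero    y = ≈-trans (+-congˡ (zeroʳ y)) (+-identityʳ 1#)
  eval-monomial (suc n) y = ≈-trans (+-identityˡ _) (*-congˡ (eval-monomial n y))

  module _ (cancel : ∀ {x y} → ¬ x ≈ 0# → x * y ≈ 0# → y ≈ 0#) where

    open GroupProperties +-group using (x∙y⁻¹≈ε⇒x≈y)

    -- Split off the linear factor of the first root. At every other root that factor is nonzero and
    -- cancels, so the quotient has the remaining roots.
    many-roots⇒zero : ∀ {n} (a ρ : Vector Carrier n) → (∀ {i j} → i < j → ¬ ρ i ≈ ρ j) →
      (∀ i → eval a (ρ i) ≈ 0#) → ∀ i → a i ≈ 0#
    many-roots⇒zero {suc n} a ρ distinct roots =
      quot-zero a r (many-roots⇒zero (quot a r) (tail ρ) (distinct ∘ ℕ.s<s) quot-roots) (roots zero)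
      where
      r = ρ zero
      quot-roots : ∀ i → eval (quot a r) (ρ (suc i)) ≈ 0#
      quot-roots i = cancel z≉0 (begin
        z * eval (quot a r) y              ≈⟨ *-congˡ (eval-congˡ (quot a r) z+r≈y) ⟨
        z * eval (quot a r) (z + r)        ≈⟨ +-identityʳ _ ⟨
        z * eval (quot a r) (z + r) + 0#   ≈⟨ +-congˡ (roots zero) ⟨
        z * eval (quot a r) (z + r) + eval a r ≈⟨ eval-quot a r z ⟨
        eval a (z + r)                     ≈⟨ eval-congˡ a z+r≈y ⟩
        eval a y                           ≈⟨ roots (suc i) ⟩
        0#                                 ∎)
        where
        y = ρ (suc i)
        z = y - r
        z+r≈y : z + r ≈ y
        z+r≈y = ≈-trans (+-assoc y (- r) r) (≈-trans (+-congˡ (-‿inverseˡ r)) (+-identityʳ y))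
        z≉0 : ¬ z ≈ 0#
        z≉0 z≈0 = distinct ℕ.z<s (≈-sym (x∙y⁻¹≈ε⇒x≈y y r z≈0))

-- `β` is the coordinate isomorphism from F^h to K and `γ` its inverse; that `γ` respects equality
-- and is linear follows from `β-inj`.
record FieldExtension {c ℓ} (F : CommutativeRing c ℓ) (h : ℕ) : Set (Level.suc (c ⊔ ℓ)) where
  private module F = CommutativeRing F
  field
    K       : CommutativeRing c ℓ
    isField : IsField K
  open CommutativeRing K public
  open VecEquality F.setoid using (_≋_)
  field
    scalar  : F.Carrier → Carrier
    β       : Vector F.Carrier h → Carrier
    β-cong  : ∀ {a b} → a ≋ b → β a ≈ β b
    β-inj   : ∀ {a b} → β a ≈ β b → a ≋ b
    β-+     : ∀ a b → β (zipWith F._+_ a b) ≈ β a + β b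
    β-*     : ∀ x a → β (map (x F.*_) a) ≈ scalar x * β a
    γ       : Carrier → Vector F.Carrier h
    β-γ     : ∀ y → β (γ y) ≈ y

-- The sequence 1 at n-1, 2n-1, … and 0 elsewhere has annihilator X^n - 1.
module PeriodicSequences {c ℓ} (F : CommutativeRing c ℓ) (isField : IsField F) (n-1 : ℕ) where

  open CommutativeRing F hiding (zero) renaming (refl to ≈-refl; sym to ≈-sym; trans to ≈-trans)
  open IsField isField
  open ShiftOperators F
  open FiniteSums F
  open SetoidReasoning setoid

  n : ℕ
  n = suc n-1

  comb : Seq
  comb m with n ∣? suc m
  ... | yes _ = 1#
  ... | no  _ = 0#

  comb-∣ : ∀ {m} → n ∣ suc m → comb m ≈ 1#
  comb-∣ {m} n∣ with n ∣? suc m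
  ... | yes _  = ≈-refl
  ... | no n∤ = contradiction n∣ n∤

  comb-∤ : ∀ {m} → ¬ n ∣ suc m → comb m ≈ 0#
  comb-∤ {m} n∤ with n ∣? suc m
  ... | yes n∣ = contradiction n∣ n∤
  ... | no _   = ≈-refl

  comb-periodic : Periodic n comb
  comb-periodic m with n ∣? suc m
  ... | yes n∣ = comb-∣ (subst (n ∣_) (ℕ.+-suc n m) (∣m∣n⇒∣m+n ∣-refl n∣))
  ... | no n∤  = comb-∤ (λ n∣ → n∤ (∣m+n∣m⇒∣n (subst (n ∣_) (sym (ℕ.+-suc n m)) n∣) ∣-refl))

  periodic-+* : ∀ {s} → Periodic n s → ∀ k m → s (m ℕ.+ k ℕ.* n) ≈ s m
  periodic-+* {s} per zero m = reflexive (cong s (ℕ.+-identityʳ m))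
  periodic-+* {s} per (suc k) m = ≈-trans (reflexive (cong s eq)) (≈-trans (per _) (periodic-+* per k m))
    where
    eq : m ℕ.+ (n ℕ.+ k ℕ.* n) ≡ n ℕ.+ (m ℕ.+ k ℕ.* n)
    eq = trans (sym (ℕ.+-assoc m n _)) (trans (cong (ℕ._+ k ℕ.* n) (ℕ.+-comm m n)) (ℕ.+-assoc n m _))

  periodic-% : ∀ {s} → Periodic n s → ∀ m → s m ≈ s (m % n)
  periodic-% {s} per m = ≈-trans (reflexive (cong s (m≡m%n+[m/n]*n m n))) (periodic-+* per (m / n) (m % n))

  periodic-≐ : ∀ {s t} → Periodic n s → Periodic n t → (∀ m → m ℕ.< n → s m ≈ t m) → s ≐ t
  periodic-≐ s-per t-per s≈t m =
    ≈-trans (periodic-% s-per m) (≈-trans (s≈t (m % n) (m%n<n m n)) (≈-sym (periodic-% t-per m)))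

  -- Comparing one period is enough; this gives the quotient rings decidable equality.
  periodic-≐? : ∀ {s t} → Periodic n s → Periodic n t → Dec (s ≐ t)
  periodic-≐? {s} {t} s-per t-per = map′
    (λ s≈t → periodic-≐ s-per t-per (λ m m<n →
      subst (λ l → s l ≈ t l) (toℕ-fromℕ< m<n) (s≈t (fromℕ< m<n))))
    (λ s≐t → s≐t ∘ toℕ)
    (all? (λ i → s (toℕ i) ≈? t (toℕ i)))

  poly-∙ : ∀ {N} (a : Vector Carrier N) s m → (poly a ∙ s) m ≈ sum (λ i → a i * s (toℕ i ℕ.+ m))
  poly-∙ {zero}  a s m = zeroˡ _
  poly-∙ {suc N} a s m = +-congˡ (≈-trans (poly-∙ (tail a) s (suc m))
    (sum-cong-≋ {N} (λ i → *-congˡ (reflexive (cong s (ℕ.+-suc (toℕ i) m))))))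

  -- Applied to `comb`, the power X^i has its 1 at position n - 1 - i of the first period, so the
  -- coefficient of X^i modulo X^n - 1 is read off there.
  coefficients : Expr → Vector Carrier n
  coefficients p i = (p ∙ comb) (toℕ (opposite i))

  poly-coefficients : ∀ p → p ∙ comb ≐ poly (coefficients p) ∙ comb
  poly-coefficients p = periodic-≐ (periodic-∙ comb-periodic p)
    (periodic-∙ comb-periodic (poly (coefficients p))) (λ m m<n → ≈-sym (value m m<n))
    where
    value : ∀ m → m ℕ.< n → (poly (coefficients p) ∙ comb) m ≈ (p ∙ comb) m
    value m m<n = begin
      (poly (coefficients p) ∙ comb) m ≈⟨ poly-∙ (coefficients p) comb m ⟩
      sum (λ i → coefficients p i * comb (toℕ i ℕ.+ m)) ≈⟨ sum-select _ i₀ others ⟩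
      coefficients p i₀ * comb (toℕ i₀ ℕ.+ m) ≈⟨ *-congˡ (comb-∣ (subst (n ∣_) (sym i₀+m) ∣-refl)) ⟩
      coefficients p i₀ * 1#          ≈⟨ *-identityʳ _ ⟩
      (p ∙ comb) (toℕ (opposite i₀))  ≡⟨ cong (λ i → (p ∙ comb) (toℕ i)) (opposite-involutive m′) ⟩
      (p ∙ comb) (toℕ m′)             ≡⟨ cong (p ∙ comb) (toℕ-fromℕ< m<n) ⟩
      (p ∙ comb) m                    ∎
      where
      m′ = fromℕ< m<n
      i₀ = opposite m′
      i₀+m : suc (toℕ i₀ ℕ.+ m) ≡ n
      i₀+m = trans (sym (ℕ.+-suc (toℕ i₀) m)) (trans
        (cong (ℕ._+ suc m) (trans (opposite-prop m′) (cong (λ l → n ∸ suc l) (toℕ-fromℕ< m<n))))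
        (ℕ.m∸n+n≡m m<n))
      others : ∀ j → j ≢ i₀ → coefficients p j * comb (toℕ j ℕ.+ m) ≈ 0#
      others j j≢i₀ = ≈-trans (*-congˡ (comb-∤ n∤)) (zeroʳ _)
        where
        n∤ : ¬ n ∣ suc (toℕ j ℕ.+ m)
        -- `suc (toℕ j + m)` is positive and below 2n, so its only possible multiple of `n` is `n`
        -- itself, attained at `i₀` alone.
        n∤ (divides 1 eq) = j≢i₀ (toℕ-injective (ℕ.+-cancelʳ-≡ m _ _
          (ℕ.suc-injective (trans eq (trans (ℕ.*-identityˡ n) (sym i₀+m))))))
        n∤ (divides (suc (suc k)) eq) = ℕ.<⇒≱ (ℕ.+-mono-<-≤ (toℕ<n j) m<n)
          (ℕ.≤-trans (ℕ.≤-trans (ℕ.+-monoʳ-≤ n (ℕ.m≤m+n n (k ℕ.* n))) (ℕ.≤-reflexive (sym eq)))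
            (ℕ.≤-reflexive (sym (ℕ.+-suc (toℕ j) m))))

  -- At position n - 1 - d the operator sees `d` zeros of `comb` followed by its first 1, so the
  -- result there is 1.
  monic⇒≉0 : ∀ {d p} → Monic d p → d ℕ.< n → ¬ p ∙ comb ≐ (λ _ → 0#)
  monic⇒≉0 {d} {p} p-monic (ℕ.s≤s d≤n-1) p∙comb≐0 = 1≉0 (begin
    1#                ≈⟨ comb-∣ (subst (n ∣_) (cong suc (sym m+d)) ∣-refl) ⟨
    comb (m ℕ.+ d)    ≈⟨ p-monic comb m zeros ⟨
    (p ∙ comb) m      ≈⟨ p∙comb≐0 m ⟩
    0#                ∎)
    where
    m = n-1 ∸ d
    m+d : m ℕ.+ d ≡ n-1
    m+d = ℕ.m∸n+n≡m d≤n-1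
    zeros : ∀ j → j ℕ.< d → comb (m ℕ.+ j) ≈ 0#
    zeros j j<d = comb-∤ (λ n∣ → ℕ.<⇒≱ (ℕ.s<s (subst (m ℕ.+ j ℕ.<_) m+d (ℕ.+-monoʳ-< m j<d))) (∣⇒≤ n∣))

-- The Frobenius map on quotients of F[X]

module FrobeniusOnQuotients {c ℓ} (F : CommutativeRing c ℓ) (isField : IsField F) {q}
  (F↔Fin : Finite (CommutativeRing.setoid F) q) {p k} (pr : Prime p) (q≡p^k : q ≡ p ℕ.^ k) where

  private module F = CommutativeRing F
  private module FExp = Exp F.commutativeSemiring
  private module FMult = Mult F.semiring
  open ShiftOperators F
  open FiniteField F isField F↔Fin using (^q≈; q·1≈0; p^k·1≈0⇒p·1≈0)

  q^i≡p^[ki] : ∀ i → q ℕ.^ i ≡ p ℕ.^ (k ℕ.* i)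
  q^i≡p^[ki] i = trans (cong (ℕ._^ i) q≡p^k) (ℕ.^-*-assoc p k i)

  ^q^i≈ : ∀ i a → a FExp.^ (q ℕ.^ i) F.≈ a
  ^q^i≈ zero a = F.*-identityʳ a
  ^q^i≈ (suc i) a = F.trans (F.sym (FExp.^-assocʳ a q (q ℕ.^ i)))
    (F.trans (FExp.^-congˡ (q ℕ.^ i) (^q≈ a)) (^q^i≈ i a))

  module _ (s : Seq) where

    open CommutativeRing (quotientRing s) hiding (zero) renaming (refl to ≈-refl; sym to ≈-sym; trans to ≈-trans)
    open Mult semiring using () renaming (_×_ to _·_)
    open Exp commutativeSemiring using (_^_; ^-distrib-*)
    open Evaluation (quotientRing s)

    con-· : ∀ n → n · con F.1# ≈ con (n FMult.× F.1#)
    con-· zero = ≈-refl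
    con-· (suc n) = congruent λ m → F.trans (F.+-congˡ (at (con-· n) m)) (F.sym (F.distribʳ (s m) _ _))

    con-^ : ∀ n a → con a ^ n ≈ con (a FExp.^ n)
    con-^ zero    a = ≈-refl
    con-^ (suc n) a = congruent λ m → F.trans (F.*-congˡ (at (con-^ n a) m)) (F.sym (F.*-assoc _ _ _))

    con-cong : ∀ {a b} → a F.≈ b → con a ≈ con b
    con-cong a≈b = congruent λ m → F.*-congʳ a≈b

    p·1≈0 : p · con F.1# ≈ con F.0#
    p·1≈0 = ≈-trans (con-· p)
      (con-cong (p^k·1≈0⇒p·1≈0 p k (subst (λ n → n FMult.× F.1# F.≈ F.0#) q≡p^k q·1≈0)))

    ^q^i-+ : ∀ i x y → (x + y) ^ (q ℕ.^ i) ≈ x ^ (q ℕ.^ i) + y ^ (q ℕ.^ i)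
    ^q^i-+ i x y rewrite q^i≡p^[ki] i = Frobenius.^p^k-+ (quotientRing s) pr p·1≈0 (k ℕ.* i) x y

    con-^q^i : ∀ i a → con a ^ (q ℕ.^ i) ≈ con a
    con-^q^i i a = ≈-trans (con-^ (q ℕ.^ i) a) (con-cong (^q^i≈ i a))

    X^≡powX : ∀ n → X ^ n ≡ powX n
    X^≡powX zero    = refl
    X^≡powX (suc n) = cong (X ⊗_) (X^≡powX n)

    -- Frobenius fixes the coefficients, so it permutes the roots of a polynomial over F.
    eval-^q^i : ∀ i {n} (a : Vector F.Carrier n) y →
      eval (con ∘ a) (y ^ (q ℕ.^ i)) ≈ eval (con ∘ a) y ^ (q ℕ.^ i)
    eval-^q^i i {zero} a y = ≈-sym (con-^q^i i F.0#)
    eval-^q^i i {suc n} a y = begin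
      con (a zero) + y^ * eval (con ∘ tail a) y^
        ≈⟨ +-congˡ (*-congˡ (eval-^q^i i (tail a) y)) ⟩
      con (a zero) + y^ * eval (con ∘ tail a) y ^ (q ℕ.^ i)
        ≈⟨ +-cong (con-^q^i i (a zero)) (^-distrib-* y _ (q ℕ.^ i)) ⟨
      con (a zero) ^ (q ℕ.^ i) + (y * eval (con ∘ tail a) y) ^ (q ℕ.^ i)
        ≈⟨ ^q^i-+ i (con (a zero)) _ ⟨
      (con (a zero) + y * eval (con ∘ tail a) y) ^ (q ℕ.^ i) ∎
      where
      open SetoidReasoning setoid
      y^ = y ^ (q ℕ.^ i)

    poly≡eval : ∀ {n} (a : Vector F.Carrier n) → poly a ≡ eval (con ∘ a) X
    poly≡eval {zero}  a = refl
    poly≡eval {suc n} a = cong (λ e → con (a zero) ⊕ X ⊗ e) (poly≡eval (tail a))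

    -- The q^h-th power respects sums and products and fixes constants. It fixes `X` because
    -- shifting by `suc n` a sequence of period `n` is shifting by 1.
    ^q^h≈ : ∀ h {n} → q ℕ.^ h ≡ suc n → Periodic n s → ∀ y → y ^ (q ℕ.^ h) ≈ y
    ^q^h≈ h q^h≡1+n per (con a) = con-^q^i h a
    ^q^h≈ h {n} q^h≡1+n per X = congruent λ m → begin
      (X ^ (q ℕ.^ h) ∙ s) m     ≡⟨ cong (λ e → (e ∙ s) m) (X^≡powX (q ℕ.^ h)) ⟩
      (powX (q ℕ.^ h) ∙ s) m    ≈⟨ powX-∙ (q ℕ.^ h) s m ⟩
      s (q ℕ.^ h ℕ.+ m)         ≡⟨ cong s (trans (cong (ℕ._+ m) q^h≡1+n) (sym (ℕ.+-suc n m))) ⟩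
      s (n ℕ.+ suc m)           ≈⟨ per (suc m) ⟩
      s (suc m)                 ∎
      where open SetoidReasoning F.setoid
    ^q^h≈ h q^h≡1+n per (x ⊕ y) =
      ≈-trans (^q^i-+ h x y) (+-cong (^q^h≈ h q^h≡1+n per x) (^q^h≈ h q^h≡1+n per y))
    ^q^h≈ h q^h≡1+n per (x ⊗ y) =
      ≈-trans (^-distrib-* x y (q ℕ.^ h)) (*-cong (^q^h≈ h q^h≡1+n per x) (^q^h≈ h q^h≡1+n per y))

    poly-cong : ∀ {n} {a b : Vector F.Carrier n} → (∀ i → a i F.≈ b i) → poly a ≈ poly b
    poly-cong {zero}  a≋b = ≈-refl
    poly-cong {suc n} a≋b = +-cong (con-cong (a≋b zero)) (*-congˡ (poly-cong (a≋b ∘ suc)))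

    poly-+ : ∀ {n} (a b : Vector F.Carrier n) → poly (zipWith F._+_ a b) ≈ poly a + poly b
    poly-+ {zero}  a b = ≈-sym (+-identityʳ (con F.0#))
    poly-+ {suc n} a b = begin
      con (a zero F.+ b zero) + X * poly (zipWith F._+_ (tail a) (tail b))
        ≈⟨ +-cong (congruent λ m → F.distribʳ (s m) _ _) (*-congˡ (poly-+ (tail a) (tail b))) ⟩
      con (a zero) + con (b zero) + X * (poly (tail a) + poly (tail b))
        ≈⟨ +-congˡ (distribˡ X (poly (tail a)) (poly (tail b))) ⟩
      con (a zero) + con (b zero) + (X * poly (tail a) + X * poly (tail b))
        ≈⟨ interchange _ _ _ _ ⟩
      (con (a zero) + X * poly (tail a)) + (con (b zero) + X * poly (tail b)) ∎
      where
      open SetoidReasoning setoid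
      open CommutativeSemigroupProperties (CommutativeMonoid.commutativeSemigroup +-commutativeMonoid)
        using (interchange)

    poly-* : ∀ {n} x (a : Vector F.Carrier n) → poly (map (x F.*_) a) ≈ con x * poly a
    poly-* {zero}  x a = ≈-sym (zeroʳ (con x))
    poly-* {suc n} x a = begin
      con (x F.* a zero) + X * poly (map (x F.*_) (tail a))
        ≈⟨ +-cong (congruent λ m → F.*-assoc x (a zero) (s m)) (*-congˡ (poly-* x (tail a))) ⟩
      con x * con (a zero) + X * (con x * poly (tail a))
        ≈⟨ +-congˡ (x∙yz≈y∙xz X (con x) _) ⟩
      con x * con (a zero) + con x * (X * poly (tail a))
        ≈⟨ distribˡ (con x) _ _ ⟨
      con x * (con (a zero) + X * poly (tail a)) ∎
      where
      open SetoidReasoning setoid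
      open CommutativeSemigroupProperties *-commutativeSemigroup using (x∙yz≈y∙xz)

-- As q and h are at least 2, q^h is at least 4. Writing it as `4 + Q` lets `n`, which is q^h - 1,
-- and the powers with exponent q^h, q^h - 1 and q^h - 2 unfold by computation.
module Existence {c ℓ} (F : CommutativeRing c ℓ) (isField : IsField F) {q}
  (F↔Fin : Finite (CommutativeRing.setoid F) q) {p k} (pr : Prime p) (q≡p^k : q ≡ p ℕ.^ k)
  (h-1 : ℕ) {Q} (q^h≡4+Q : q ℕ.^ suc h-1 ≡ 4 ℕ.+ Q) where

  private module F = CommutativeRing F
  open IsField isField using (*-cancel-0) renaming (_≈?_ to _F≈?_; 1≉0 to F1≉0)
  open VecEquality F.setoid using (_≋_)
  open ShiftOperators F
  open PeriodicSequences F isField (2 ℕ.+ Q)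
  open FrobeniusOnQuotients F isField F↔Fin {p} {k} pr q≡p^k

  private
    h = suc h-1
    2≤q = 2≤order F isField F↔Fin

  conjugate-difference : ℕ → Expr
  conjugate-difference d = powX (q ℕ.^ d) ⊕ con (F.- F.1#) ⊗ X

  separator : ℕ → Expr
  separator zero    = con F.1#
  separator (suc d) = separator d ⊗ conjugate-difference (suc d)

  degree : ℕ → ℕ
  degree zero    = 0
  degree (suc d) = degree d ℕ.+ q ℕ.^ suc d

  monic-separator : ∀ d → Monic (degree d) (separator d)
  monic-separator zero    = monic-1
  monic-separator (suc d) = monic-⊗ {p = separator d} {r = conjugate-difference (suc d)} (monic-separator d)
    (monic-powX-X (ℕ.≤-trans 2≤q (ℕ.m≤m*n q (q ℕ.^ d) {{ℕ.m^n≢0 q d {{ℕ.>-nonZero (ℕ.<-trans ℕ.z<s 2≤q)}}}})))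

  -- The summand `q` closes the induction, as twice `q ^ suc d` is at most `q ^ suc (suc d)`. It
  -- also leaves the slack of 2 by which `degree<n` gets strictly below q^h - 1.
  degree+q≤ : ∀ d → degree d ℕ.+ q ≤ q ℕ.^ suc d
  degree+q≤ zero = ℕ.≤-reflexive (sym (ℕ.*-identityʳ q))
  degree+q≤ (suc d) = begin
    degree d ℕ.+ q ℕ.^ suc d ℕ.+ q     ≡⟨ ℕ.+-assoc (degree d) _ q ⟩
    degree d ℕ.+ (q ℕ.^ suc d ℕ.+ q)   ≡⟨ cong (degree d ℕ.+_) (ℕ.+-comm (q ℕ.^ suc d) q) ⟩
    degree d ℕ.+ (q ℕ.+ q ℕ.^ suc d)   ≡⟨ ℕ.+-assoc (degree d) q _ ⟨
    degree d ℕ.+ q ℕ.+ q ℕ.^ suc d     ≤⟨ ℕ.+-monoˡ-≤ (q ℕ.^ suc d) (degree+q≤ d) ⟩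
    q ℕ.^ suc d ℕ.+ q ℕ.^ suc d        ≡⟨ cong (q ℕ.^ suc d ℕ.+_) (sym (ℕ.+-identityʳ _)) ⟩
    2 ℕ.* q ℕ.^ suc d                  ≤⟨ ℕ.*-monoˡ-≤ (q ℕ.^ suc d) 2≤q ⟩
    q ℕ.^ suc (suc d)                  ∎
    where open ℕ.≤-Reasoning

  degree<n : degree h-1 ℕ.< n
  degree<n = ℕ.s≤s⁻¹ (begin
    suc (suc (degree h-1)) ≡⟨ ℕ.+-comm 2 (degree h-1) ⟩
    degree h-1 ℕ.+ 2    ≤⟨ ℕ.+-monoʳ-≤ (degree h-1) 2≤q ⟩
    degree h-1 ℕ.+ q    ≤⟨ degree+q≤ h-1 ⟩
    q ℕ.^ h             ≡⟨ q^h≡4+Q ⟩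
    4 ℕ.+ Q             ∎)
    where open ℕ.≤-Reasoning

  module _ where
    private R = quotientRing comb
    open CommutativeRing R hiding (zero) renaming (refl to ≈-refl; sym to ≈-sym; trans to ≈-trans)
    open Exp commutativeSemiring using (_^_)
    open PrimeElement R
    open CommutativeSemigroupProperties *-commutativeSemigroup using (x∙yz≈y∙xz)
    open SetoidReasoning setoid

    e : Expr
    e = separator h-1

    e≉0 : ¬ e ≈ 0#
    e≉0 e≈0 = monic⇒≉0 {p = e} (monic-separator h-1) degree<n (λ m → F.trans (at e≈0 m) (F.zeroˡ _))

    _≟0 : ∀ x → Dec (x ≈ 0#)
    x ≟0 = map′ congruent at
      (periodic-≐? (periodic-∙ {n} comb-periodic x) (periodic-∙ {n} comb-periodic (con F.0#)))

    -- `v` equals its q^h-th power, which is a multiple of its cube.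
    reduced : ∀ {v} → v * (v * v) ≈ 0# → v ≈ 0#
    reduced {v} v³≈0 = begin
      v                            ≈⟨ ^q^h≈ comb h q^h≡4+Q comb-periodic v ⟨
      v ^ (q ℕ.^ h)                ≡⟨ cong (v ^_) q^h≡4+Q ⟩
      v * (v * (v * (v * v ^ Q)))  ≈⟨ *-congˡ (*-assoc v v (v * v ^ Q)) ⟨
      v * (v * v * (v * v ^ Q))    ≈⟨ *-assoc v (v * v) (v * v ^ Q) ⟨
      v * (v * v) * (v * v ^ Q)    ≈⟨ *-congʳ v³≈0 ⟩
      0# * (v * v ^ Q)             ≈⟨ zeroˡ (v * v ^ Q) ⟩
      0#                           ∎

    private vectors = finite-power F.setoid F↔Fin n

    -- `select` runs over all polynomials with `n` coefficients, which exhaust R. The result is a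
    -- multiple of `e`, so `v * e ≈ 0#` would make its cube vanish.
    prime-separator : ∃[ v ] ¬ v ≈ 0# × ¬ v * e ≈ 0# ×
      (∀ {x y} → v * (x * y) ≈ 0# → v * x ≈ 0# ⊎ v * y ≈ 0#)
    prime-separator with v , v≉0 , (a , v≈ae) , split ← select _≟0 (poly ∘ Inverse.from vectors) e e≉0 =
      v , v≉0 , ve≉0 , prime reduced v≉0 split′
      where
      split′ : ∀ x → v * x ≈ 0# ⊎ x ∣ᴿ v
      split′ x = Sum.map (≈-trans (*-congˡ x≈g)) (λ (t , v≈) → t , ≈-trans v≈ (*-congˡ (≈-sym x≈g))) (split i)
        where
        i = Inverse.to vectors (coefficients x)
        x≈g : x ≈ poly (Inverse.from vectors i)
        x≈g = ≈-trans (congruent (poly-coefficients x))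
          (poly-cong comb (λ j → F.sym (Inverse.strictlyInverseʳ vectors (coefficients x) j)))
      ve≉0 : ¬ v * e ≈ 0#
      ve≉0 ve≈0 = v≉0 (reduced (begin
        v * (v * v)          ≈⟨ *-congˡ (*-congˡ v≈ae) ⟩
        v * (v * (a * e))    ≈⟨ *-congˡ (x∙yz≈y∙xz v a e) ⟩
        v * (a * (v * e))    ≈⟨ *-congˡ (*-congˡ ve≈0) ⟩
        v * (a * 0#)         ≈⟨ *-congˡ (zeroʳ a) ⟩
        v * 0#               ≈⟨ zeroʳ v ⟩
        0#                   ∎))

  private module R = CommutativeRing (quotientRing comb)

  -- An expression annihilates `v ∙ comb` exactly when its product with `v` is zero in R. So
  -- `quotientRing t` is R/Ann(v), and `prime` says that it has no zero divisors.
  module Residue (v : Expr) (v≉0 : ¬ v R.≈ R.0#) (ve≉0 : ¬ v R.* separator h-1 R.≈ R.0#)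
    (prime : ∀ {x y} → v R.* (x R.* y) R.≈ R.0# → v R.* x R.≈ R.0# ⊎ v R.* y R.≈ R.0#) where

    t : Seq
    t = v ∙ comb

    t-periodic : Periodic n t
    t-periodic = periodic-∙ comb-periodic v

    K : CommutativeRing c ℓ
    K = quotientRing t

    open CommutativeRing K hiding (zero) renaming (refl to ≈-refl; sym to ≈-sym; trans to ≈-trans)
    open Exp commutativeSemiring using (_^_; ^-congˡ; ^-assocʳ)
    open Evaluation K
    open SetoidReasoning setoid

    _≈?_ : Decidable _≈_
    x ≈? y = map′ congruent at (periodic-≐? (periodic-∙ t-periodic x) (periodic-∙ t-periodic y))

    ≈0⇒v*≈0 : ∀ {x} → x ≈ 0# → v R.* x R.≈ R.0#
    ≈0⇒v*≈0 {x} x≈0 = congruent λ m →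
      F.trans (∙-comm v x comb m) (F.trans (at x≈0 m) (F.trans (F.zeroˡ _) (F.sym (F.zeroˡ _))))

    v*≈0⇒≈0 : ∀ {x} → v R.* x R.≈ R.0# → x ≈ 0#
    v*≈0⇒≈0 {x} vx≈0 = congruent λ m → F.trans (∙-comm x v comb m)
      (F.trans (at vx≈0 m) (F.trans (F.zeroˡ _) (F.sym (F.zeroˡ _))))

    cancel : ∀ {x y} → ¬ x ≈ 0# → x * y ≈ 0# → y ≈ 0#
    cancel x≉0 xy≈0 with prime (≈0⇒v*≈0 xy≈0)
    ... | inj₁ vx≈0 = contradiction (v*≈0⇒≈0 vx≈0) x≉0
    ... | inj₂ vy≈0 = v*≈0⇒≈0 vy≈0

    ^≉0 : ∀ {x} → ¬ x ≈ 0# → ¬ 1# ≈ 0# → ∀ i → ¬ x ^ i ≈ 0#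
    ^≉0 x≉0 1≉0 zero    = 1≉0
    ^≉0 x≉0 1≉0 (suc i) = ^≉0 x≉0 1≉0 i ∘ cancel x≉0

    -- A nonzero constant that annihilates `t` could be cancelled, giving `t` = 0 and hence `v` = 0
    -- in R.
    con≈0⇒≈0 : ∀ {a} → con a ≈ 0# → a F.≈ F.0#
    con≈0⇒≈0 {a} con≈0 with a F≈? F.0#
    ... | yes a≈0 = a≈0
    ... | no  a≉0 = contradiction
      (congruent λ m → F.trans (*-cancel-0 a≉0 (F.trans (at con≈0 m) (F.zeroˡ _))) (F.sym (F.zeroˡ _))) v≉0

    1≉0 : ¬ 1# ≈ 0#
    1≉0 = F1≉0 ∘ con≈0⇒≈0

    separator≉0 : ¬ separator h-1 ≈ 0#
    separator≉0 = ve≉0 ∘ ≈0⇒v*≈0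

    -- The difference is one of the factors of `separator h-1`, which survives in K.
    conjugate≉X : ∀ d → d ℕ.< h-1 → ¬ X ^ (q ℕ.^ suc d) ≈ X
    conjugate≉X d d<h-1 eq = separator≉0 (vanish (ℕ.≤⇒≤′ d<h-1))
      where
      difference≈0 : conjugate-difference (suc d) ≈ 0#
      difference≈0 = ≈-trans (+-congʳ {con (F.- F.1#) ⊗ X} (≈-trans (reflexive (sym (X^≡powX t (q ℕ.^ suc d)))) eq))
        (-‿inverseʳ X)
      vanish : ∀ {i} → suc d ℕ.≤′ i → separator i ≈ 0#
      vanish ℕ.≤′-refl = ≈-trans (*-congˡ difference≈0) (zeroʳ (separator d))
      vanish (ℕ.≤′-step {i} le) = ≈-trans (*-congʳ (vanish le)) (zeroˡ (conjugate-difference (suc i)))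

    -- The power map is additive, and a nonzero element has no vanishing power.
    ^q^i-inj : ∀ i {x y} → x ^ (q ℕ.^ i) ≈ y ^ (q ℕ.^ i) → x ≈ y
    ^q^i-inj i {x} {y} eq = x∙y⁻¹≈ε⇒x≈y x y (decidable-stable (z ≈? 0#) λ z≉0 → ^≉0 z≉0 1≉0 (q ℕ.^ i) z^≈0)
      where
      open GroupProperties +-group using (x∙y⁻¹≈ε⇒x≈y; identityʳ-unique)
      z = x - y
      y+z≈x : y + z ≈ x
      y+z≈x = ≈-trans (+-comm y z) (≈-trans (+-assoc x (- y) y) (≈-trans (+-congˡ (-‿inverseˡ y)) (+-identityʳ x)))
      z^≈0 : z ^ (q ℕ.^ i) ≈ 0#
      z^≈0 = identityʳ-unique (y ^ (q ℕ.^ i)) _ (begin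
        y ^ (q ℕ.^ i) + z ^ (q ℕ.^ i)   ≈⟨ ^q^i-+ t i y z ⟨
        (y + z) ^ (q ℕ.^ i)             ≈⟨ ^-congˡ (q ℕ.^ i) y+z≈x ⟩
        x ^ (q ℕ.^ i)                   ≈⟨ eq ⟩
        y ^ (q ℕ.^ i)                   ∎)

    conjugates-distinct : ∀ {i j : Fin h} → i < j → ¬ X ^ (q ℕ.^ toℕ i) ≈ X ^ (q ℕ.^ toℕ j)
    conjugates-distinct {i} {j} i<j eq = conjugate≉X d d<h-1
      (^q^i-inj (toℕ i) (begin
        (X ^ (q ℕ.^ suc d)) ^ (q ℕ.^ toℕ i)  ≈⟨ ^-assocʳ X (q ℕ.^ suc d) (q ℕ.^ toℕ i) ⟩
        X ^ (q ℕ.^ suc d ℕ.* q ℕ.^ toℕ i)    ≡⟨ cong (X ^_) (ℕ.^-distribˡ-+-* q (suc d) (toℕ i)) ⟨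
        X ^ (q ℕ.^ (suc d ℕ.+ toℕ i))        ≡⟨ cong (λ l → X ^ (q ℕ.^ l)) 1+d+i≡j ⟩
        X ^ (q ℕ.^ toℕ j)                    ≈⟨ eq ⟨
        X ^ (q ℕ.^ toℕ i)                    ∎))
      where
      -- Undoing the i-th Frobenius power turns a collision of two conjugates into one of `X` with
      -- its conjugate of index j - i, which is `suc d`.
      d = toℕ j ∸ suc (toℕ i)
      1+d+i≡j : suc d ℕ.+ toℕ i ≡ toℕ j
      1+d+i≡j = trans (sym (ℕ.+-suc d (toℕ i))) (ℕ.m∸n+n≡m i<j)
      d<h-1 : d ℕ.< h-1
      d<h-1 = ℕ.≤-trans (ℕ.s≤s (ℕ.m≤m+n d (toℕ i)))
        (ℕ.≤-trans (ℕ.≤-reflexive 1+d+i≡j) (ℕ.s≤s⁻¹ (toℕ<n j)))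

    -- The h distinct conjugates of X are roots of every polynomial over F with root X.
    poly≈0⇒≋0 : ∀ (a : Vector F.Carrier h) → poly a ≈ 0# → ∀ i → a i F.≈ F.0#
    poly≈0⇒≋0 a poly≈0 i = con≈0⇒≈0 (many-roots⇒zero cancel (con ∘ a)
      (λ i → X ^ (q ℕ.^ toℕ i)) conjugates-distinct roots i)
      where
      roots : ∀ j → eval (con ∘ a) (X ^ (q ℕ.^ toℕ j)) ≈ 0#
      roots j = begin
        eval (con ∘ a) (X ^ (q ℕ.^ toℕ j))   ≈⟨ eval-^q^i t (toℕ j) a X ⟩
        eval (con ∘ a) X ^ (q ℕ.^ toℕ j)     ≡⟨ cong (_^ (q ℕ.^ toℕ j)) (poly≡eval t a) ⟨
        poly a ^ (q ℕ.^ toℕ j)               ≈⟨ ^-congˡ (q ℕ.^ toℕ j) poly≈0 ⟩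
        con F.0# ^ (q ℕ.^ toℕ j)             ≈⟨ con-^q^i t (toℕ j) F.0# ⟩
        0#                                   ∎

    poly-inj : ∀ {a b : Vector F.Carrier h} → poly a ≈ poly b → a ≋ b
    poly-inj {a} {b} eq i = x∙y⁻¹≈ε⇒x≈y (a i) (b i) (F.trans (F.+-congˡ (F.sym (-1*x≈-x (b i))))
      (poly≈0⇒≋0 (zipWith F._+_ a (map (F.- F.1# F.*_) b)) difference≈0 i))
      where
      open GroupProperties F.+-group using (x∙y⁻¹≈ε⇒x≈y)
      open RingProperties F.ring using (-1*x≈-x)
      difference≈0 : poly (zipWith F._+_ a (map (F.- F.1# F.*_) b)) ≈ 0#
      difference≈0 = begin
        poly (zipWith F._+_ a (map (F.- F.1# F.*_) b)) ≈⟨ poly-+ t a (map (F.- F.1# F.*_) b) ⟩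
        poly a + poly (map (F.- F.1# F.*_) b)          ≈⟨ +-cong eq (poly-* t (F.- F.1#) b) ⟩
        poly b - poly b                                ≈⟨ -‿inverseʳ (poly b) ⟩
        0#                                             ∎

    ^[4+Q]≈ : ∀ x → x ^ (4 ℕ.+ Q) ≈ x
    ^[4+Q]≈ x = subst (λ l → x ^ l ≈ x) q^h≡4+Q (^q^h≈ t h q^h≡4+Q t-periodic x)

    isField-K : IsField K
    isField-K = record
      { _≈?_ = _≈?_
      ; 1≉0 = 1≉0
      -- The inverse is the power with exponent q^h - 2: cancel `x` in x^(q^h) - x = 0.
      ; inverse = λ x x≉0 → x ^ (2 ℕ.+ Q) , x∙y⁻¹≈ε⇒x≈y _ 1# (cancel x≉0 (begin
          x * (x ^ (3 ℕ.+ Q) - 1#)        ≈⟨ distribˡ x (x ^ (3 ℕ.+ Q)) (- 1#) ⟩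
          x ^ (4 ℕ.+ Q) + x * - 1#        ≈⟨ +-cong (^[4+Q]≈ x) (*-comm x (- 1#)) ⟩
          x + - 1# * x                    ≈⟨ +-congˡ (-1*x≈-x x) ⟩
          x - x                           ≈⟨ -‿inverseʳ x ⟩
          0#                              ∎)) }
      where
      open GroupProperties +-group using (x∙y⁻¹≈ε⇒x≈y)
      open RingProperties ring using (-1*x≈-x)

    -- Y^Q - Y has at most Q roots, so the Q combinations of 1, X, …, X^(h-1) exhaust K.
    poly-surjective : ∀ y → ∃[ a ] poly {h} a ≈ y
    poly-surjective y = decidable-stable
      (finite⇒any? (≋-setoid h) vectors (λ a≋b → ≈-trans (≈-sym (poly-cong t a≋b))) (λ a → poly a ≈? y))
      λ ∄a → 1≉0 (begin
        1#         ≈⟨ +-identityʳ 1# ⟨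
        1# + 0#    ≈⟨ +-congˡ (many-roots⇒zero cancel Y^Q-Y (ρ ∄a) (distinct ∄a) (roots ∘ ρ ∄a) (suc zero)) ⟨
        1# - 1#    ≈⟨ -‿inverseʳ 1# ⟩
        0#         ∎)
      where
      open VecEquality F.setoid using (≋-setoid)
      open RingProperties ring using (-1*x≈-x)
      vectors : Finite (≋-setoid h) (4 ℕ.+ Q)
      vectors = subst (Finite (≋-setoid h)) q^h≡4+Q (finite-power F.setoid F↔Fin h)
      open Inverse vectors using (from; to-cong; strictlyInverseˡ)
      -- The coefficients of Y^(4+Q) - Y. A missed `y` together with the 4 + Q values of `poly`
      -- would give 5 + Q distinct roots, forcing the coefficient -1 of Y to vanish.
      Y^Q-Y : Vector Expr (suc (4 ℕ.+ Q))
      Y^Q-Y = 0# ∷ - 1# ∷ monomial (2 ℕ.+ Q)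
      roots : ∀ x → eval Y^Q-Y x ≈ 0#
      roots x = begin
        0# + x * (- 1# + x * eval (monomial (2 ℕ.+ Q)) x) ≈⟨ +-identityˡ _ ⟩
        x * (- 1# + x * eval (monomial (2 ℕ.+ Q)) x) ≈⟨ *-congˡ (+-congˡ (*-congˡ (eval-monomial (2 ℕ.+ Q) x))) ⟩
        x * (- 1# + x ^ (3 ℕ.+ Q))               ≈⟨ distribˡ x (- 1#) _ ⟩
        x * - 1# + x ^ (4 ℕ.+ Q)                 ≈⟨ +-cong (≈-trans (*-comm x (- 1#)) (-1*x≈-x x)) (^[4+Q]≈ x) ⟩
        - x + x                                  ≈⟨ -‿inverseˡ x ⟩
        0#                                       ∎
      module _ (∄a : ¬ (∃[ a ] poly {h} a ≈ y)) where
        ρ : Vector Expr (suc (4 ℕ.+ Q))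
        ρ = y ∷ (poly ∘ from)
        distinct : ∀ {i j} → i < j → ¬ ρ i ≈ ρ j
        distinct {zero}  {suc j} _ eq = ∄a (from j , ≈-sym eq)
        distinct {suc i} {suc j} i<j eq = ℕ.<⇒≢ i<j (cong (suc ∘ toℕ)
          (trans (sym (strictlyInverseˡ i)) (trans (to-cong (poly-inj eq)) (strictlyInverseˡ j))))

    extension : FieldExtension F h
    extension = record
      { K = K
      ; isField = isField-K
      ; scalar = con
      ; β = poly
      ; β-cong = poly-cong t
      ; β-inj = poly-inj
      ; β-+ = poly-+ t
      ; β-* = poly-* t
      ; γ = proj₁ ∘ poly-surjective
      ; β-γ = proj₂ ∘ poly-surjective }

  residue-field : FieldExtension F h
  residue-field =
    let v , v≉0 , ve≉0 , prime = prime-separator in Residue.extension v v≉0 ve≉0 prime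

field-extension : ∀ {c ℓ} (F : CommutativeRing c ℓ) → IsField F → ∀ {q} →
  Finite (CommutativeRing.setoid F) q → ∀ {p k} → Prime p → q ≡ p ℕ.^ k →
  ∀ h → 2 ≤ h → FieldExtension F h
field-extension F isField {q} F↔Fin {k = k} pr q≡p^k (suc h-1) 2≤h =
  Existence.residue-field F isField F↔Fin {k = k} pr q≡p^k h-1 (sym (ℕ.m+[n∸m]≡n 4≤q^h))
  where
  4≤q^h : 4 ≤ q ℕ.^ suc h-1
  4≤q^h = ℕ.≤-trans (ℕ.^-monoˡ-≤ 2 2≤q) (ℕ.^-monoʳ-≤ q {{ℕ.>-nonZero (ℕ.<-trans ℕ.z<s 2≤q)}} 2≤h)
    where 2≤q = 2≤order F isField F↔Fin

-- Linear algebra over a finite field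

-- Tightness shows only that a nonzero `a` cannot fail to be apart from 0. By finiteness the
-- existence of an inverse is decidable, so the double negation can be removed.
finite⇒isField : ∀ {c ℓ₁ ℓ₂} (F : HeytingField c ℓ₁ ℓ₂) {q} → HasOrder F q →
  IsField (HeytingCommutativeRing.commutativeRing (HeytingField.heytingCommutativeRing F))
finite⇒isField F order = record
  { _≈?_ = finite⇒≟ setoid order
  ; 1≉0 = λ 1≈0 → proj₂ (tight 1# 0#) 1≈0 (invertible⇒# (1# ,
      F-trans (*-identityˡ _) 1-0≈1 , F-trans (*-identityʳ _) 1-0≈1))
  ; inverse = λ a a≉0 → decidable-stable
      (finite⇒any? setoid order (λ b≈b′ ab≈1 → F-trans (*-congˡ (F-sym b≈b′)) ab≈1)
        (λ b → finite⇒≟ setoid order (a * b) 1#))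
      λ ∄b → a≉0 (proj₁ (tight a 0#) λ a#0 → let b , _ , eq = #⇒invertible a#0 in
        ∄b (b , F-trans (*-congʳ (F-sym (x-0≈x a))) eq)) }
  where
  open HeytingField F using (heytingCommutativeRing; tight; #⇒invertible; invertible⇒#)
  open CommutativeRing (HeytingCommutativeRing.commutativeRing heytingCommutativeRing)
    renaming (trans to F-trans; sym to F-sym)
  open RingProperties ring using (-0#≈0#)
  x-0≈x : ∀ x → x - 0# ≈ x
  x-0≈x x = F-trans (+-congˡ -0#≈0#) (+-identityʳ x)
  1-0≈1 = x-0≈x 1#

module LinearAlgebra {c ℓ₁ ℓ₂} (HF : HeytingField c ℓ₁ ℓ₂) {q} (order : HasOrder HF q) where

  F : CommutativeRing c ℓ₁
  F = HeytingCommutativeRing.commutativeRing (HeytingField.heytingCommutativeRing HF)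

  F-isField : IsField F
  F-isField = finite⇒isField HF order

  open CommutativeRing F hiding (zero) renaming (refl to ≈-refl; sym to ≈-sym; trans to ≈-trans)
  open IsField F-isField using (_≈?_; inverse)
  open FiniteSums F
  open VecEquality setoid using (_≋_; ≋-setoid; ≋-sym; ≋-trans)
  open RingProperties ring using (-1*x≈-x)
  open GroupProperties +-group using (x∙y⁻¹≈ε⇒x≈y)
  open SetoidReasoning setoid

  0⃗ : ∀ {r} → Vector Carrier r
  0⃗ _ = 0#

  _≋?_ : ∀ {r} (v w : Vector Carrier r) → Dec (v ≋ w)
  v ≋? w = all? (λ i → v i ≈? w i)

  dot : ∀ {r} → Vector Carrier r → Vector Carrier r → Carrier
  dot φ v = sum (λ i → φ i * v i)

  record IsLinear {r} (L : Vector Carrier r → Carrier) : Set (c ⊔ ℓ₁) where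
    field
      ≋-cong : ∀ {v w} → v ≋ w → L v ≈ L w
      +-homo : ∀ v w → L (zipWith _+_ v w) ≈ L v + L w
      *-homo : ∀ a v → L (map (a *_) v) ≈ a * L v

    0-homo : L 0⃗ ≈ 0#
    0-homo = ≈-trans (≋-cong (λ _ → ≈-sym (zeroˡ 0#))) (≈-trans (*-homo 0# 0⃗) (zeroˡ _))

    linComb-homo : ∀ {d} a (b : Vector (Vector Carrier r) d) →
      L (linComb HF a b) ≈ sum (λ j → a j * L (b j))
    linComb-homo {zero}  a b = 0-homo
    linComb-homo {suc d} a b = ≈-trans
      (+-homo (map (a zero *_) (b zero)) (linComb HF (tail a) (tail b)))
      (+-cong (*-homo (a zero) (b zero)) (linComb-homo (tail a) (tail b)))

    linComb-zero : ∀ {d} a (b : Vector (Vector Carrier r) d) → (∀ j → L (b j) ≈ 0#) → L (linComb HF a b) ≈ 0#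
    linComb-zero a b Lb≈0 = ≈-trans (linComb-homo a b)
      (sum-zero _ (λ j → ≈-trans (*-congˡ (Lb≈0 j)) (zeroʳ (a j))))

  open IsLinear

  dot-linear : ∀ {r} (φ : Vector Carrier r) → IsLinear (dot φ)
  dot-linear {r} φ = record
    { ≋-cong = λ v≋w → sum-cong-≋ {r} (λ i → *-congˡ (v≋w i))
    ; +-homo = λ v w → ≈-trans (sum-cong-≋ {r} (λ i → distribˡ (φ i) (v i) (w i))) (∑-distrib-+ {r} _ _)
    ; *-homo = λ a v → ≈-trans (sum-cong-≋ {r} (λ i → x∙yz≈y∙xz (φ i) a (v i))) (≈-sym (*-distribˡ-sum {r} a _)) }
    where open CommutativeSemigroupProperties *-commutativeSemigroup using (x∙yz≈y∙xz)

  dot-comm : ∀ {r} (φ v : Vector Carrier r) → dot φ v ≈ dot v φ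
  dot-comm {r} φ v = sum-cong-≋ {r} (λ i → *-comm (φ i) (v i))

  dot-congˡ : ∀ {r} {φ ψ : Vector Carrier r} v → φ ≋ ψ → dot φ v ≈ dot ψ v
  dot-congˡ {r} v φ≋ψ = sum-cong-≋ {r} (λ i → *-congʳ (φ≋ψ i))

  unit : ∀ {r} → Fin r → Vector Carrier r
  unit i j with i ≟ j
  ... | yes _ = 1#
  ... | no  _ = 0#

  unit-≡ : ∀ {r} (i : Fin r) → unit i i ≈ 1#
  unit-≡ i with i ≟ i
  ... | yes _  = ≈-refl
  ... | no i≢i = contradiction refl i≢i

  unit-≢ : ∀ {r} {i j : Fin r} → i ≢ j → unit i j ≈ 0#
  unit-≢ {i = i} {j} i≢j with i ≟ j
  ... | yes i≡j = contradiction i≡j i≢j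
  ... | no _    = ≈-refl

  linComb-unit : ∀ {r} (v : Vector Carrier r) → linComb HF v unit ≋ v
  linComb-unit v i = ≈-trans
    (sum-select _ i (λ j j≢i → ≈-trans (*-congˡ (unit-≢ j≢i)) (zeroʳ (v j))))
    (≈-trans (*-congˡ (unit-≡ i)) (*-identityʳ (v i)))

  linear-unit : ∀ {r} {L : Vector Carrier r → Carrier} → IsLinear L → (∀ i → L (unit i) ≈ 0#) → ∀ v → L v ≈ 0#
  linear-unit L-linear L≈0 v = ≈-trans (≋-cong L-linear (≋-sym (linComb-unit v))) (linComb-zero L-linear v unit L≈0)

  dot-unit : ∀ {r} (φ : Vector Carrier r) i → dot φ (unit i) ≈ φ i
  dot-unit φ i = ≈-trans
    (sum-select _ i (λ j j≢i → ≈-trans (*-congˡ (unit-≢ (j≢i ∘ sym))) (zeroʳ (φ j))))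
    (≈-trans (*-congˡ (unit-≡ i)) (*-identityʳ (φ i)))

  -- There are more functionals on F^r than tuples of values at d < r vectors.
  annihilator : ∀ {r d} (b : Vector (Vector Carrier r) d) → d ℕ.< r →
    ∃[ φ ] ¬ φ ≋ 0⃗ × (∀ j → dot φ (b j) ≈ 0#)
  annihilator {r} {d} b d<r =
    let i , j , i<j , eq = pigeonhole (ℕ.^-monoʳ-< q 2≤q d<r) (encode ∘ values ∘ decode)
        -- The difference of two distinct functionals that agree on `b`.
        φ = zipWith _-_ (decode i) (decode j)
    in φ
     , (λ φ≋0 → ℕ.<⇒≢ i<j (cong toℕ (trans (sym (strictlyInverseˡ functionals i))
         (trans (to-cong functionals (λ l → x∙y⁻¹≈ε⇒x≈y _ _ (φ≋0 l))) (strictlyInverseˡ functionals j)))))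
     , λ l → begin
         dot φ (b l)                                 ≈⟨ dot-comm φ (b l) ⟩
         dot (b l) φ
           ≈⟨ ≋-cong (dot-linear (b l)) (λ m → +-congˡ (≈-sym (-1*x≈-x (decode j m)))) ⟩
         dot (b l) (zipWith _+_ (decode i) (map (- 1# *_) (decode j))) ≈⟨ +-homo (dot-linear (b l)) _ _ ⟩
         dot (b l) (decode i) + dot (b l) (map (- 1# *_) (decode j))
           ≈⟨ +-congˡ (*-homo (dot-linear (b l)) (- 1#) (decode j)) ⟩
         dot (b l) (decode i) + - 1# * dot (b l) (decode j) ≈⟨ +-congˡ (-1*x≈-x _) ⟩
         dot (b l) (decode i) - dot (b l) (decode j) ≈⟨ +-congʳ (values-injective (decode i) (decode j) eq l) ⟩
         dot (b l) (decode j) - dot (b l) (decode j) ≈⟨ -‿inverseʳ _ ⟩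
         0#                                          ∎
    where
    open Inverse
    functionals = finite-power setoid order r
    tuples = finite-power setoid order d
    decode = from functionals
    encode = to tuples
    values : Vector Carrier r → Vector Carrier d
    values φ l = dot (b l) φ
    values-injective : ∀ φ ψ → encode (values φ) ≡ encode (values ψ) → values φ ≋ values ψ
    values-injective φ ψ eq = ≋-trans (≋-sym (strictlyInverseʳ tuples (values φ)))
      (≋-trans (from-cong tuples eq) (strictlyInverseʳ tuples (values ψ)))
    2≤q : 2 ≤ q
    2≤q = 2≤order F F-isField order

  ≉0⇒nonzero-entry : ∀ {r} (φ : Vector Carrier r) → ¬ φ ≋ 0⃗ → ∃[ i ] ¬ φ i ≈ 0#
  ≉0⇒nonzero-entry φ φ≉0 = decidable-stable (any? (λ i → ¬? (φ i ≈? 0#)))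
    λ ∄i → φ≉0 (λ i → decidable-stable (φ i ≈? 0#) (λ φi≉0 → ∄i (i , φi≉0)))

  kernel : ∀ {r} → Vector Carrier r → Subspace HF r
  kernel φ = record
    { Member = λ v → Lift (c ⊔ ℓ₁) (dot φ v ≈ 0#)
    ; resp = λ v≋w (lift φv≈0) → lift (≈-trans (≋-cong φ-linear (≋-sym v≋w)) φv≈0)
    ; 0-closed = lift (0-homo φ-linear)
    ; +-closed = λ {v} {w} (lift φv≈0) (lift φw≈0) →
        lift (≈-trans (+-homo φ-linear v w) (≈-trans (+-cong φv≈0 φw≈0) (+-identityˡ 0#)))
    ; *-closed = λ a {v} (lift φv≈0) →
        lift (≈-trans (*-homo φ-linear a v) (≈-trans (*-congˡ φv≈0) (zeroʳ a))) }
    where φ-linear = dot-linear φ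

  -- If φ j ≉ 0, each vector e_i with i ≠ j has a unique multiple of e_j to be added to lie in the kernel.
  kernel-isHyperplane : ∀ {r} (φ : Vector Carrier r) → ¬ φ ≋ 0⃗ → IsHyperplane HF (kernel φ)
  kernel-isHyperplane {zero}  φ φ≉0 = contradiction (λ ()) φ≉0
  kernel-isHyperplane {suc r} φ φ≉0 = r , refl , b , record
    { members = λ i → lift (b-member i)
    ; independent = λ a ab≋0 i → ≈-trans (≈-sym (linComb-punchIn a i)) (ab≋0 (punchIn j i))
    ; spanning = λ v (lift φv≈0) → removeAt v j , λ i → ≈-sym (spans v φv≈0 i) }
    where
    j = proj₁ (≉0⇒nonzero-entry φ φ≉0)
    φj⁻¹ = proj₁ (inverse (φ j) (proj₂ (≉0⇒nonzero-entry φ φ≉0)))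
    φjφj⁻¹≈1 = proj₂ (inverse (φ j) (proj₂ (≉0⇒nonzero-entry φ φ≉0)))
    b : Vector (Vector Carrier (suc r)) r
    b i = insertAt (unit i) j (- (φj⁻¹ * φ (punchIn j i)))
    dot-insertAt : ∀ v x → dot φ (insertAt v j x) ≈ φ j * x + dot (removeAt φ j) v
    dot-insertAt v x = ≈-trans (sum-remove {i = j} (λ i → φ i * insertAt v j x i))
      (+-cong (*-congˡ (reflexive (insertAt-lookup v j x)))
              (sum-cong-≋ {r} (λ i → *-congˡ (reflexive (insertAt-punchIn v j x i)))))
    φj*-[φj⁻¹*x]≈-x : ∀ x → φ j * - (φj⁻¹ * x) ≈ - x
    φj*-[φj⁻¹*x]≈-x x = begin
      φ j * - (φj⁻¹ * x)    ≈⟨ -‿distribʳ-* (φ j) (φj⁻¹ * x) ⟨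
      - (φ j * (φj⁻¹ * x))  ≈⟨ -‿cong (*-assoc (φ j) φj⁻¹ x) ⟨
      - (φ j * φj⁻¹ * x)    ≈⟨ -‿cong (*-congʳ φjφj⁻¹≈1) ⟩
      - (1# * x)            ≈⟨ -‿cong (*-identityˡ x) ⟩
      - x                   ∎
      where open RingProperties ring using (-‿distribʳ-*)
    b-member : ∀ i → dot φ (b i) ≈ 0#
    b-member i = begin
      dot φ (b i)                                               ≈⟨ dot-insertAt (unit i) _ ⟩
      φ j * - (φj⁻¹ * φ (punchIn j i)) + dot (removeAt φ j) (unit i)
        ≈⟨ +-cong (φj*-[φj⁻¹*x]≈-x _) (dot-unit (removeAt φ j) i) ⟩
      - φ (punchIn j i) + φ (punchIn j i)                       ≈⟨ -‿inverseˡ _ ⟩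
      0#                                                        ∎
    linComb-punchIn : ∀ a i → linComb HF a b (punchIn j i) ≈ a i
    linComb-punchIn a i = ≈-trans
      (sum-cong-≋ {r} (λ l → *-congˡ (reflexive (insertAt-punchIn (unit l) j _ i))))
      (linComb-unit a i)
    -- Both sides lie in the kernel and agree off j, and φ j ≉ 0.
    spans : ∀ v → dot φ v ≈ 0# → linComb HF (removeAt v j) b ≋ v
    spans v φv≈0 = agree (linComb HF (removeAt v j) b) v
      (linComb-zero (dot-linear φ) (removeAt v j) b b-member) φv≈0 (linComb-punchIn (removeAt v j))
      where
      entry : ∀ w → dot φ w ≈ 0# → w j ≈ - (φj⁻¹ * dot (removeAt φ j) (removeAt w j))
      entry w φw≈0 = inverseˡ-unique (w j) _ (begin
        w j + φj⁻¹ * S               ≈⟨ +-congʳ (*-identityˡ (w j)) ⟨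
        1# * w j + φj⁻¹ * S          ≈⟨ +-congʳ (*-congʳ (≈-trans (*-comm φj⁻¹ (φ j)) φjφj⁻¹≈1)) ⟨
        φj⁻¹ * φ j * w j + φj⁻¹ * S  ≈⟨ +-congʳ (*-assoc φj⁻¹ (φ j) (w j)) ⟩
        φj⁻¹ * (φ j * w j) + φj⁻¹ * S ≈⟨ distribˡ φj⁻¹ _ _ ⟨
        φj⁻¹ * (φ j * w j + S)       ≈⟨ *-congˡ (sum-remove {i = j} (λ i → φ i * w i)) ⟨
        φj⁻¹ * dot φ w               ≈⟨ *-congˡ φw≈0 ⟩
        φj⁻¹ * 0#                    ≈⟨ zeroʳ φj⁻¹ ⟩
        0#                           ∎)
        where
        open GroupProperties +-group using (inverseˡ-unique)
        S = dot (removeAt φ j) (removeAt w j)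
      agree : ∀ w w′ → dot φ w ≈ 0# → dot φ w′ ≈ 0# → removeAt w j ≋ removeAt w′ j → w ≋ w′
      agree w w′ φw≈0 φw′≈0 w≋w′ i with j ≟ i
      ... | yes refl = ≈-trans (entry w φw≈0) (≈-trans
        (-‿cong (*-congˡ (≋-cong (dot-linear (removeAt φ j)) w≋w′))) (≈-sym (entry w′ φw′≈0)))
      ... | no j≢i = subst (λ l → w l ≈ w′ l) (punchIn-punchOut j≢i) (w≋w′ (punchOut j≢i))

  linComb-closed : ∀ {r d} (W : Subspace HF r) a (b : Vector (Vector Carrier r) d) →
    (∀ j → Member W (b j)) → Member W (linComb HF a b)
  linComb-closed {d = zero}  W a b b∈W = 0-closed W
  linComb-closed {d = suc d} W a b b∈W =
    +-closed W (*-closed W (a zero) (b∈W zero)) (linComb-closed W (tail a) (tail b) (b∈W ∘ suc))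

  linComb-congˡ : ∀ {r d} {a a′ : Vector Carrier d} (b : Vector (Vector Carrier r) d) →
    a ≋ a′ → linComb HF a b ≋ linComb HF a′ b
  linComb-congˡ b a≋a′ i = dot-congˡ (λ j → b j i) a≋a′

  linComb-linear : ∀ {r d} (b : Vector (Vector Carrier r) d) i → IsLinear (λ a → linComb HF a b i)
  linComb-linear b i = record
    { ≋-cong = λ a≋a′ → linComb-congˡ b a≋a′ i
    ; +-homo = λ a a′ → ≈-trans (dot-comm _ col) (≈-trans (+-homo (dot-linear col) a a′)
        (+-cong (dot-comm col a) (dot-comm col a′)))
    ; *-homo = λ x a → ≈-trans (dot-comm _ col) (≈-trans (*-homo (dot-linear col) x a)
        (*-congˡ (dot-comm col a))) }
    where col = λ j → b j i

  span : ∀ {r d} → Vector (Vector Carrier r) d → Subspace HF r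
  span b = record
    { Member = λ v → ∃[ a ] v ≋ linComb HF a b
    ; resp = λ v≋w (a , v≋) → a , ≋-trans (≋-sym v≋w) v≋
    ; 0-closed = 0⃗ , λ i → ≈-sym (0-homo (linComb-linear b i))
    ; +-closed = λ (a , v≋) (a′ , w≋) → zipWith _+_ a a′ ,
        λ i → ≈-trans (+-cong (v≋ i) (w≋ i)) (≈-sym (+-homo (linComb-linear b i) a a′))
    ; *-closed = λ x (a , v≋) → map (x *_) a ,
        λ i → ≈-trans (*-congˡ (v≋ i)) (≈-sym (*-homo (linComb-linear b i) x a)) }

  ∈-span : ∀ {r d} (b : Vector (Vector Carrier r) d) j → Member (span b) (b j)
  ∈-span b j = unit j , λ i → ≈-sym (≈-trans (dot-comm (unit j) (λ l → b l i)) (dot-unit (λ l → b l i) j))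

  span⊑⇒ : ∀ {r d} (b : Vector (Vector Carrier r) d) (W : Subspace HF r) →
    _⊑_ HF (span b) W → ∀ j → Member W (b j)
  span⊑⇒ b W b⊑W j = b⊑W (∈-span b j)

  ⇒span⊑ : ∀ {r d} (b : Vector (Vector Carrier r) d) (W : Subspace HF r) →
    (∀ j → Member W (b j)) → _⊑_ HF (span b) W
  ⇒span⊑ b W b∈W (a , v≋) = resp W (≋-sym v≋) (linComb-closed W a b b∈W)

  -- `Member W` is an arbitrary predicate; a basis turns it into a search over the finitely many
  -- coefficient vectors.
  hasDim⇒∈? : ∀ {r d} {W : Subspace HF r} → HasDim HF W d → ∀ v → Dec (Member W v)
  hasDim⇒∈? {d = d} {W} (b , basis) v = map′
    (λ (a , v≋) → resp W (≋-sym v≋) (linComb-closed W a b (IsBasis.members basis)))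
    (IsBasis.spanning basis v)
    (finite⇒any? (≋-setoid d) (finite-power setoid order d)
      (λ a≋a′ v≋ → ≋-trans v≋ (linComb-congˡ b a≋a′)) (λ a → v ≋? linComb HF a b))

  dependent? : ∀ {r d} (b : Vector (Vector Carrier r) d) → Dec (∃[ a ] ¬ a ≋ 0⃗ × linComb HF a b ≋ 0⃗)
  dependent? {d = d} b = finite⇒any? (≋-setoid d) (finite-power setoid order d)
    (λ a≋a′ (a≉0 , ab≋0) → a≉0 ∘ ≋-trans a≋a′ , ≋-trans (≋-sym (linComb-congˡ b a≋a′)) ab≋0)
    (λ a → ¬? (a ≋? 0⃗) ×-dec (linComb HF a b ≋? 0⃗))

  -- As long as there is a nontrivial relation, a vector with nonzero coefficient in it is dropped.
  basis-extraction : ∀ {r} d (U : Subspace HF r) (b : Vector (Vector Carrier r) d) →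
    (∀ j → Member U (b j)) → (∀ v → Member U v → ∃[ a ] v ≋ linComb HF a b) →
    ∃[ d′ ] d′ ≤ d × HasDim HF U d′
  basis-extraction d U b b∈U spanning with dependent? b
  ... | no independent = d , ℕ.≤-refl , b , record
    { members = b∈U
    ; independent = λ a ab≋0 → decidable-stable (a ≋? 0⃗) (λ a≉0 → independent (a , a≉0 , ab≋0))
    ; spanning = spanning }
  basis-extraction zero U b b∈U spanning | yes (a , a≉0 , _) = contradiction (λ ()) a≉0
  basis-extraction (suc d) U b b∈U spanning | yes (a , a≉0 , ab≋0) =
    let d′ , d′≤d , dim = basis-extraction d U (removeAt b j) (b∈U ∘ punchIn j) spanning′
    in d′ , ℕ.m≤n⇒m≤1+n d′≤d , dim
    where
    j = proj₁ (≉0⇒nonzero-entry a a≉0)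
    aj⁻¹ = proj₁ (inverse (a j) (proj₂ (≉0⇒nonzero-entry a a≉0)))
    ajaj⁻¹≈1 = proj₂ (inverse (a j) (proj₂ (≉0⇒nonzero-entry a a≉0)))
    spanning′ : ∀ v → Member U v → ∃[ x ] v ≋ linComb HF x (removeAt b j)
    spanning′ v v∈U with x , v≋xb ← spanning v v∈U = removeAt y j , λ i → begin
      v i                                                        ≈⟨ v≋xb i ⟩
      linComb HF x b i                                           ≈⟨ +-identityʳ _ ⟨
      linComb HF x b i + 0#                                      ≈⟨ +-congˡ (≈-trans (*-congˡ (ab≋0 i)) (zeroʳ s)) ⟨
      linComb HF x b i + s * linComb HF a b i                    ≈⟨ +-congˡ (*-homo (linComb-linear b i) s a) ⟨
      linComb HF x b i + linComb HF (map (s *_) a) b i           ≈⟨ +-homo (linComb-linear b i) x (map (s *_) a) ⟨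
      linComb HF y b i                                           ≈⟨ sum-remove {i = j} (λ l → y l * b l i) ⟩
      y j * b j i + linComb HF (removeAt y j) (removeAt b j) i   ≈⟨ +-congʳ (≈-trans (*-congʳ yj≈0) (zeroˡ _)) ⟩
      0# + linComb HF (removeAt y j) (removeAt b j) i            ≈⟨ +-identityˡ _ ⟩
      linComb HF (removeAt y j) (removeAt b j) i                 ∎
      where
      -- Adding this multiple of the relation `a` clears the coefficient of the dropped vector.
      s = - (x j * aj⁻¹)
      y = zipWith _+_ x (map (s *_) a)
      yj≈0 : y j ≈ 0#
      yj≈0 = begin
        x j + - (x j * aj⁻¹) * a j    ≈⟨ +-congˡ (-‿distribˡ-* (x j * aj⁻¹) (a j)) ⟨
        x j - x j * aj⁻¹ * a j        ≈⟨ +-congˡ (-‿cong (*-assoc (x j) aj⁻¹ (a j))) ⟩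
        x j - x j * (aj⁻¹ * a j)      ≈⟨ +-congˡ (-‿cong (*-congˡ (≈-trans (*-comm aj⁻¹ (a j)) ajaj⁻¹≈1))) ⟩
        x j - x j * 1#                ≈⟨ +-congˡ (-‿cong (*-identityʳ (x j))) ⟩
        x j - x j                     ≈⟨ -‿inverseʳ (x j) ⟩
        0#                            ∎
        where open RingProperties ring using (-‿distribˡ-*)

-- Systems with at most two members in a hyperplane

comprehension : ∀ {p n} {P : Fin n → Set p} → Unary.Decidable P → ∃[ K ] (∀ i → (i ∈ K) ⇔ P i)
comprehension {n = zero} P? = Vec.[] , λ ()
comprehension {n = suc n} P? with K , K⇔P ← comprehension (P? ∘ suc) | P? zero
... | yes P0 = inside Vec.∷ K , λ
  { zero    → mk⇔ (λ _ → P0) (λ _ → here)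
  ; (suc i) → mk⇔ (λ { (there i∈K) → Equivalence.to (K⇔P i) i∈K }) (there ∘ Equivalence.from (K⇔P i)) }
... | no ¬P0 = outside Vec.∷ K , λ
  { zero    → mk⇔ (λ ()) (λ P0 → contradiction P0 ¬P0)
  ; (suc i) → mk⇔ (λ { (there i∈K) → Equivalence.to (K⇔P i) i∈K }) (there ∘ Equivalence.from (K⇔P i)) }

-- Generating families instead of subspaces, and functionals instead of hyperplanes,
-- make the notion a finite search.
module Arcs {c ℓ₁ ℓ₂} (HF : HeytingField c ℓ₁ ℓ₂) {q} (order : HasOrder HF q) (r h : ℕ) where

  open LinearAlgebra HF order
  open CommutativeRing F hiding (zero) renaming (refl to ≈-refl; sym to ≈-sym; trans to ≈-trans)
  open IsField F-isField using (_≈?_)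
  open IsLinear
  open VecEquality setoid using (_≋_; ≋-setoid; ≋-sym; ≋-trans; ≋-refl)

  Family : ℕ → Set c
  Family = Vector (Vector Carrier r)

  Kills : ∀ {d} → Vector Carrier r → Family d → Set ℓ₁
  Kills φ b = ∀ j → dot φ (b j) ≈ 0#

  kills? : ∀ {d} φ (b : Family d) → Dec (Kills φ b)
  kills? φ b = all? (λ j → dot φ (b j) ≈? 0#)

  kills-resp : ∀ {d} {φ ψ} {b b′ : Family d} → φ ≋ ψ → (∀ j → b j ≋ b′ j) → Kills φ b → Kills ψ b′
  kills-resp {ψ = ψ} {b} φ≋ψ b≋b′ φb≈0 j =
    ≈-trans (≋-cong (dot-linear ψ) (≋-sym (b≋b′ j))) (≈-trans (dot-congˡ (b j) (≋-sym φ≋ψ)) (φb≈0 j))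

  NoThreeKilled : ∀ {n} → Vector (Family h) n → Vector Carrier r → Set ℓ₁
  NoThreeKilled b φ = ∀ i j l → i < j → j < l → ¬ (Kills φ (b i) × Kills φ (b j) × Kills φ (b l))

  IsArc : ∀ {n} → Vector (Family h) n → Set (c ⊔ ℓ₁)
  IsArc b = ∀ φ → ¬ φ ≋ 0⃗ → NoThreeKilled b φ

  -- Each member has exactly `h` generators, possibly zero or dependent, so for given `n` the
  -- candidates form a finite set.
  Arc : ℕ → Set (c ⊔ ℓ₁)
  Arc n = ∃[ b ] IsArc {n} b

  arc? : ∀ n → Dec (Arc n)
  arc? n = finite⇒any? families-setoid families
    (λ b≋b′ arc φ φ≉0 i j l i<j j<l (φbi , φbj , φbl) → arc φ φ≉0 i j l i<j j<l
      ( kills-resp ≋-refl (λ m → ≋-sym (b≋b′ i m)) φbi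
      , kills-resp ≋-refl (λ m → ≋-sym (b≋b′ j m)) φbj
      , kills-resp ≋-refl (λ m → ≋-sym (b≋b′ l m)) φbl))
    (λ b → finite⇒all? (≋-setoid r) (finite-power setoid order r)
      (λ φ≋ψ none ψ≉0 i j l i<j j<l (ψbi , ψbj , ψbl) → none (ψ≉0 ∘ ≋-trans (≋-sym φ≋ψ)) i j l i<j j<l
        ( kills-resp (≋-sym φ≋ψ) (λ _ → ≋-refl) ψbi
        , kills-resp (≋-sym φ≋ψ) (λ _ → ≋-refl) ψbj
        , kills-resp (≋-sym φ≋ψ) (λ _ → ≋-refl) ψbl))
      (λ φ → ¬? (φ ≋? 0⃗) →-dec all? (λ i → all? (λ j → all? (λ l →
        (i <? j) →-dec (j <? l) →-dec ¬? (kills? φ (b i) ×-dec kills? φ (b j) ×-dec kills? φ (b l)))))))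
    where
    open VecEquality (≋-setoid r) using () renaming (≋-setoid to family-setoid)
    open VecEquality (family-setoid h) using () renaming (≋-setoid to families-setoid′)
    families-setoid = families-setoid′ n
    families = finite-power (family-setoid h) (finite-power (≋-setoid r) (finite-power setoid order r) h) n

  -- Since `h < r`, every member is killed by some nonzero functional. Beyond this bound three
  -- members would share theirs.
  arc-bound : h ℕ.< r → ∀ n → Arc n → n ≤ suc (q ℕ.^ r) ℕ.* suc (q ℕ.^ r)
  arc-bound h<r n (b , arc) with n ℕ.≤? suc (q ℕ.^ r) ℕ.* suc (q ℕ.^ r)
  ... | yes n≤B = n≤B
  ... | no  n≰B =
    let i , j , l , i<j , j<l , φi≡φj , φj≡φl = pigeonhole₃ (Inverse.to functionals ∘ φ ∘ index)
    in contradiction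
      ( kills-resp (φ≋ (trans φi≡φj φj≡φl)) (λ _ → ≋-refl) (φ-kills (index i))
      , kills-resp (φ≋ φj≡φl) (λ _ → ≋-refl) (φ-kills (index j))
      , φ-kills (index l))
      (arc (φ (index l)) (proj₁ (proj₂ (annihilator (b (index l)) h<r)))
        (index i) (index j) (index l) (index-mono i<j) (index-mono j<l))
    where
    functionals = finite-power setoid order r
    φ : Fin n → Vector Carrier r
    φ i = proj₁ (annihilator (b i) h<r)
    φ-kills : ∀ i → Kills (φ i) (b i)
    φ-kills i = proj₂ (proj₂ (annihilator (b i) h<r))
    B≤n = ℕ.<⇒≤ (ℕ.≰⇒> n≰B)
    index : Fin (suc (q ℕ.^ r) ℕ.* suc (q ℕ.^ r)) → Fin n
    index i = inject≤ i B≤n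
    index-mono : ∀ {i j} → i < j → index i < index j
    index-mono {i} {j} = subst₂ ℕ._<_ (sym (toℕ-inject≤ i B≤n)) (sym (toℕ-inject≤ j B≤n))
    φ≋ : ∀ {v w} → Inverse.to functionals v ≡ Inverse.to functionals w → v ≋ w
    φ≋ {v} {w} eq = ≋-trans (≋-sym (Inverse.strictlyInverseʳ functionals v))
      (≋-trans (Inverse.from-cong functionals eq) (Inverse.strictlyInverseʳ functionals w))

  pad : ∀ {d} → d ≤ h → Family d → Family h
  pad {d} d≤h b j with toℕ j ℕ.<? d
  ... | yes j<d = b (fromℕ< j<d)
  ... | no  _   = 0⃗

  kills-pad : ∀ {d} (d≤h : d ≤ h) φ (b : Family d) → Kills φ (pad d≤h b) → Kills φ b
  kills-pad {d} d≤h φ b φb≈0 i with φb≈0 (inject≤ i d≤h)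
  ... | φbi≈0 with toℕ (inject≤ i d≤h) ℕ.<? d
  ...   | yes i<d = subst (λ l → dot φ (b l) ≈ 0#)
    (trans (fromℕ<-cong _ _ (toℕ-inject≤ i d≤h) i<d (toℕ<n i)) (fromℕ<-toℕ i (toℕ<n i))) φbi≈0
  ...   | no i≮d = contradiction (subst (ℕ._< d) (sym (toℕ-inject≤ i d≤h)) (toℕ<n i)) i≮d

  -- Bases are padded with zeros to length `h`. A functional that kills three members would have
  -- them in its kernel, a hyperplane.
  system⇒arc : ∀ {n} → ProjectiveSystemExists HF h n r 2 → Arc n
  system⇒arc {n} (U , system) = b , arc
    where
    open IsProjectiveSystem system
    d≤h : ∀ i → proj₁ (dim≤h i) ≤ h
    d≤h i = proj₁ (proj₂ (dim≤h i))
    basis : ∀ i → Family (proj₁ (dim≤h i))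
    basis i = proj₁ (proj₂ (proj₂ (dim≤h i)))
    b : Vector (Family h) n
    b i = pad (d≤h i) (basis i)
    ⊑kernel : ∀ {φ} i → Kills φ (b i) → _⊑_ HF (U i) (kernel φ)
    ⊑kernel {φ} i φb≈0 {v} v∈U = let a , v≋ = IsBasis.spanning (proj₂ (proj₂ (proj₂ (dim≤h i)))) v v∈U in
      resp (kernel φ) (≋-sym v≋) (linComb-closed (kernel φ) a (basis i)
        (λ j → lift (kills-pad (d≤h i) φ (basis i) φb≈0 j)))
    arc : IsArc b
    arc φ φ≉0 i j l i<j j<l (φbi , φbj , φbl) =
      let m , m≤2 , K , K⇔ , ∣K∣≡m = at-most (kernel φ) (kernel-isHyperplane φ φ≉0)
          member = λ i φbi → Equivalence.from (K⇔ i) (⊑kernel i φbi)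
      in ℕ.<⇒≱ (∈∈∈⇒3≤∣∣ i<j j<l (member i φbi) (member j φbj) (member l φbl))
               (ℕ.≤-trans (ℕ.≤-reflexive ∣K∣≡m) m≤2)

  -- Every hyperplane is killed by a nonzero functional, hence the bound 2. It is attained because
  -- two members have 2h < r generators together, so one functional kills both.
  arc⇒system : h ℕ.+ h ℕ.< r → ∀ {n} → 2 ≤ n → Arc n → ProjectiveSystemExists HF h n r 2
  arc⇒system h+h<r {n} 2≤n (b , arc) = U , record
    { dim≤h = λ i → basis-extraction h (U i) (b i) (∈-span (b i)) (λ _ v∈U → v∈U)
    ; at-most = λ H hyperplane →
        let K , K⇔ = contained H hyperplane in ∣ K ∣ , ≤2 H hyperplane K K⇔ , K , K⇔ , refl
    ; attained = kernel φ , ker-hyperplane ,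
        (let K , K⇔ = contained (kernel φ) ker-hyperplane
         in K , K⇔ , ℕ.≤-antisym (≤2 (kernel φ) ker-hyperplane K K⇔)
           (∈∈⇒2≤∣∣ {i = i₀} {i₁} i₀<i₁
             (Equivalence.from (K⇔ i₀) (⇒span⊑ (b i₀) (kernel φ) (λ j → lift (φ-kills₀ j))))
             (Equivalence.from (K⇔ i₁) (⇒span⊑ (b i₁) (kernel φ) (λ j → lift (φ-kills₁ j)))))) }
    where
    U : Vector (Subspace HF r) n
    U = span ∘ b
    contained : ∀ H → IsHyperplane HF H → ∃[ K ] (∀ i → (i ∈ K) ⇔ _⊑_ HF (U i) H)
    contained H (_ , _ , dim) = comprehension λ i →
      map′ (⇒span⊑ (b i) H) (span⊑⇒ (b i) H) (all? (λ j → hasDim⇒∈? {W = H} dim (b i j)))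
    ≤2 : ∀ H → IsHyperplane HF H → ∀ K → (∀ i → (i ∈ K) ⇔ _⊑_ HF (U i) H) → ∣ K ∣ ≤ 2
    ≤2 H (d , 1+d≡r , basis , isBasis) K K⇔ = ℕ.≮⇒≥ λ 3≤∣K∣ →
      let i , j , l , i<j , j<l , i∈K , j∈K , l∈K = three-∈ 3≤∣K∣
          ψ , ψ≉0 , ψ-kills = annihilator basis (ℕ.≤-reflexive 1+d≡r)
          killed = λ i i∈K m →
            let a , v≋ = IsBasis.spanning isBasis (b i m) (Equivalence.to (K⇔ i) i∈K (∈-span (b i) m))
            in ≈-trans (≋-cong (dot-linear ψ) v≋) (linComb-zero (dot-linear ψ) a basis ψ-kills)
      in arc ψ ψ≉0 i j l i<j j<l (killed i i∈K , killed j j∈K , killed l l∈K)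
    i₀ i₁ : Fin n
    i₀ = inject≤ zero 2≤n
    i₁ = inject≤ (suc zero) 2≤n
    i₀<i₁ : i₀ < i₁
    i₀<i₁ = subst₂ ℕ._<_ (sym (toℕ-inject≤ zero 2≤n)) (sym (toℕ-inject≤ (suc zero) 2≤n)) ℕ.z<s
    φ-data = annihilator (b i₀ ++ b i₁) h+h<r
    φ = proj₁ φ-data
    ker-hyperplane = kernel-isHyperplane φ (proj₁ (proj₂ φ-data))
    φ-kills₀ : Kills φ (b i₀)
    φ-kills₀ j = subst (λ v → dot φ v ≈ 0#) (lookup-++ˡ (b i₀) (b i₁) j) (proj₂ (proj₂ φ-data) (j ↑ˡ h))
    φ-kills₁ : Kills φ (b i₁)
    φ-kills₁ j = subst (λ v → dot φ v ≈ 0#) (lookup-++ʳ (b i₀) (b i₁) j) (proj₂ (proj₂ φ-data) (h ↑ʳ j))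

  -- The maximum is found among arcs, which are decidable and bounded; being at least 2, it carries
  -- over to systems.
  arc⇒maximum : h ℕ.+ h ℕ.< r → ∀ {m} → 2 ≤ m → Arc m → ∃[ N ] IsMaxSize HF r h 2 N × m ≤ N
  arc⇒maximum h+h<r 2≤m arc =
    let N , (arc-N , N-max) , m≤N = bounded⇒maximum arc? _ (arc-bound (ℕ.≤-<-trans (ℕ.m≤m+n h h) h+h<r)) arc
    in N , (arc⇒system h+h<r (ℕ.≤-trans 2≤m m≤N) arc-N , λ n system → N-max n (system⇒arc system)) , m≤N

-- The construction

-- Here ⌊h/2⌋ = k, π keeps the first k of the h = k + w coordinates, and T, T′ are spanned by the last w,
-- respectively the first k, unit vectors.
module Construction {c ℓ₁ ℓ₂} (HF : HeytingField c ℓ₁ ℓ₂) {q} (order : HasOrder HF q)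
  (k w : ℕ) (k≤w : k ≤ w) (E : FieldExtension (LinearAlgebra.F HF order) (k ℕ.+ w)) where

  open LinearAlgebra HF order

  private
    module F where
      open CommutativeRing F public
      open CommutativeSemigroupProperties (CommutativeMonoid.commutativeSemigroup +-commutativeMonoid) public
        using (interchange)

  open FieldExtension E hiding (zero) renaming (refl to ≈-refl; sym to ≈-sym; trans to ≈-trans)
  open IsField isField using (inverse)
  open FiniteSums F
  open IsLinear
  open VecEquality F.setoid using (_≋_; ≋-sym)

  h r : ℕ
  h = k ℕ.+ w
  r = h ℕ.+ (h ℕ.+ k)

  open Arcs HF order r h

  dot-++ : ∀ m {n} (φ : Vector F.Carrier (m ℕ.+ n)) v u →
    dot φ (v ++ u) F.≈ dot (take m φ) v F.+ dot (drop m φ) u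
  dot-++ m {n} φ v u = F.trans (sum-split m _) (F.+-cong
    (sum-cong-≋ {m} (λ i → F.*-congˡ (F.reflexive (lookup-++ˡ v u i))))
    (sum-cong-≋ {n} (λ j → F.*-congˡ (F.reflexive (lookup-++ʳ v u j)))))
    where
    sum-split : ∀ m {n} (f : Vector F.Carrier (m ℕ.+ n)) → sum f F.≈ sum (take m f) F.+ sum (drop m f)
    sum-split zero    f = F.sym (F.+-identityˡ _)
    sum-split (suc m) f = F.trans (F.+-congˡ (sum-split m (tail f))) (F.sym (F.+-assoc _ _ _))

  take-drop-zero : ∀ m {n} (φ : Vector F.Carrier (m ℕ.+ n)) → take m φ ≋ 0⃗ → drop m φ ≋ 0⃗ → φ ≋ 0⃗
  take-drop-zero m {n} φ take≋0 drop≋0 i = subst (λ l → φ l F.≈ F.0#) (join-splitAt m n i) (go (splitAt m i))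
    where
    go : ∀ s → φ (join m n s) F.≈ F.0#
    go (inj₁ i) = take≋0 i
    go (inj₂ j) = drop≋0 j

  γ-cong : ∀ {x y} → x ≈ y → γ x ≋ γ y
  γ-cong x≈y = β-inj (≈-trans (β-γ _) (≈-trans x≈y (≈-sym (β-γ _))))

  γ-β : ∀ a → γ (β a) ≋ a
  γ-β a = β-inj (β-γ (β a))

  γ-+ : ∀ x y → γ (x + y) ≋ zipWith F._+_ (γ x) (γ y)
  γ-+ x y = β-inj (≈-trans (β-γ _) (≈-sym (≈-trans (β-+ (γ x) (γ y)) (+-cong (β-γ x) (β-γ y)))))

  γ-* : ∀ a x → γ (scalar a * x) ≋ map (a F.*_) (γ x)
  γ-* a x = β-inj (≈-trans (β-γ _) (≈-sym (≈-trans (β-* a (γ x)) (*-congˡ (β-γ x)))))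

  record IsFunctional (f : Carrier → F.Carrier) : Set (c ⊔ ℓ₁) where
    field
      f-cong   : ∀ {x y} → x ≈ y → f x F.≈ f y
      f-+      : ∀ x y → f (x + y) F.≈ f x F.+ f y
      f-scalar : ∀ a x → f (scalar a * x) F.≈ a F.* f x

    on-coordinates : IsLinear (f ∘ β)
    on-coordinates = record
      { ≋-cong = f-cong ∘ β-cong
      ; +-homo = λ u v → F.trans (f-cong (β-+ u v)) (f-+ (β u) (β v))
      ; *-homo = λ a v → F.trans (f-cong (β-* a v)) (f-scalar a (β v)) }

    -- A member lists generators only for the basis elements of K; this extends their equations to
    -- all `y`.
    zero-on-basis⇒zero : (∀ i → f (β (unit i)) F.≈ F.0#) → ∀ y → f y F.≈ F.0#
    zero-on-basis⇒zero f≈0 y = F.trans (f-cong (≈-sym (β-γ y))) (linear-unit on-coordinates f≈0 (γ y))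

  open IsFunctional

  dot-γ : ∀ ψ → IsFunctional (dot ψ ∘ γ)
  dot-γ ψ = record
    { f-cong = ≋-cong (dot-linear ψ) ∘ γ-cong
    ; f-+ = λ x y → F.trans (≋-cong (dot-linear ψ) (γ-+ x y)) (+-homo (dot-linear ψ) (γ x) (γ y))
    ; f-scalar = λ a x → F.trans (≋-cong (dot-linear ψ) (γ-* a x)) (*-homo (dot-linear ψ) a (γ x)) }

  dot-take-γ : ∀ ψ → IsFunctional (dot ψ ∘ take k ∘ γ)
  dot-take-γ ψ = record
    { f-cong = λ x≈y → ≋-cong (dot-linear ψ) (γ-cong x≈y ∘ (_↑ˡ w))
    ; f-+ = λ x y → F.trans (≋-cong (dot-linear ψ) (γ-+ x y ∘ (_↑ˡ w)))
        (+-homo (dot-linear ψ) (take k (γ x)) (take k (γ y)))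
    ; f-scalar = λ a x → F.trans (≋-cong (dot-linear ψ) (γ-* a x ∘ (_↑ˡ w)))
        (*-homo (dot-linear ψ) a (take k (γ x))) }

  _⊞_ : ∀ {f g} → IsFunctional f → IsFunctional g → IsFunctional (λ y → f y F.+ g y)
  F₁ ⊞ F₂ = record
    { f-cong = λ x≈y → F.+-cong (f-cong F₁ x≈y) (f-cong F₂ x≈y)
    ; f-+ = λ x y → F.trans (F.+-cong (f-+ F₁ x y) (f-+ F₂ x y)) (F.interchange _ _ _ _)
    ; f-scalar = λ a x → F.trans (F.+-cong (f-scalar F₁ a x) (f-scalar F₂ a x)) (F.sym (F.distribˡ a _ _)) }

  _∘*_ : ∀ {f} → IsFunctional f → ∀ a → IsFunctional (λ y → f (a * y))
  F₁ ∘* a = record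
    { f-cong = f-cong F₁ ∘ *-congˡ
    ; f-+ = λ x y → F.trans (f-cong F₁ (distribˡ a x y)) (f-+ F₁ (a * x) (a * y))
    ; f-scalar = λ b x → F.trans (f-cong F₁ (x∙yz≈y∙xz a (scalar b) x)) (f-scalar F₁ b (a * x)) }
    where open CommutativeSemigroupProperties *-commutativeSemigroup using (x∙yz≈y∙xz)

  -- Division by a - b in the divided differences: any `y` is written as `z * u`. The form
  -- `z + b ≈ a` lets `a` be eliminated without subtraction.
  module Difference {a b} (a≉b : ¬ a ≈ b) (y : Carrier) where

    z : Carrier
    z = a - b

    z+b≈a : z + b ≈ a
    z+b≈a = ≈-trans (+-assoc a (- b) b) (≈-trans (+-congˡ (-‿inverseˡ b)) (+-identityʳ a))

    z≉0 : ¬ z ≈ 0#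
    z≉0 z≈0 = a≉b (≈-trans (≈-sym z+b≈a) (≈-trans (+-congʳ z≈0) (+-identityˡ b)))

    z⁻¹ u : Carrier
    z⁻¹ = proj₁ (inverse z z≉0)
    u = z⁻¹ * y

    y≈zu : y ≈ z * u
    y≈zu = ≈-sym (≈-trans (≈-sym (*-assoc z z⁻¹ y))
      (≈-trans (*-congʳ (proj₂ (inverse z z≉0))) (*-identityˡ y)))

  point : Carrier → Family h
  point a j = γ y ++ (γ (a * y) ++ take k (γ (a * (a * y))))
    where y = β (unit j)

  third-block : Family k
  third-block i = unit (h ↑ʳ (h ↑ʳ i))

  V₁ : Family (w ℕ.+ k)
  V₁ = (λ i → unit (h ↑ʳ ((k ↑ʳ i) ↑ˡ k))) ++ third-block

  V₂ : Family (k ℕ.+ k)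
  V₂ = (λ i → unit (h ↑ʳ ((i ↑ˡ w) ↑ˡ k))) ++ third-block

  kills-++ : ∀ {d e} φ (b : Family d) (b′ : Family e) → Kills φ (b ++ b′) → Kills φ b × Kills φ b′
  kills-++ {d} {e} φ b b′ φbb′≈0 =
    (λ i → subst (λ v → dot φ v F.≈ F.0#) (lookup-++ˡ b b′ i) (φbb′≈0 (i ↑ˡ e))) ,
    (λ j → subst (λ v → dot φ v F.≈ F.0#) (lookup-++ʳ b b′ j) (φbb′≈0 (d ↑ʳ j)))

  kills-units : ∀ {d} φ (ι : Fin d → Fin r) → Kills φ (unit ∘ ι) → ∀ i → φ (ι i) F.≈ F.0#
  kills-units φ ι φι≈0 i = F.trans (F.sym (dot-unit φ (ι i))) (φι≈0 i)

  -- Functionals killing several members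

  module _ (φ : Vector F.Carrier r) where

    private
      φ₁ φ₂ : Vector F.Carrier h
      φ₁ = take h φ
      φ₂ = take h (drop h φ)
      φ₃ : Vector F.Carrier k
      φ₃ = drop h (drop h φ)

      f₁ f₂ f₃ : Carrier → F.Carrier
      f₁ = dot φ₁ ∘ γ
      f₂ = dot φ₂ ∘ γ
      f₃ = dot φ₃ ∘ take k ∘ γ

    VanishesAt : Carrier → Set _
    VanishesAt a = ∀ y → f₁ y F.+ (f₂ (a * y) F.+ f₃ (a * (a * y))) F.≈ F.0#

    kills-point : ∀ a → Kills φ (point a) → VanishesAt a
    kills-point a φa≈0 = zero-on-basis⇒zero
      (dot-γ φ₁ ⊞ ((dot-γ φ₂ ∘* a) ⊞ ((dot-take-γ φ₃ ∘* a) ∘* a)))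
      λ i → F.trans (F.sym (F.trans (dot-++ h φ _ _) (F.+-congˡ (dot-++ h (drop h φ) _ _)))) (φa≈0 i)

    -- First divided difference: subtract the conditions at `u`, where y = (a - b)u, and use a² - b²
    -- = (a + b)(a - b). The calculation adds `D` to the condition at `b` and reaches that at `a`.
    two-points : ∀ {a b} → ¬ a ≈ b → VanishesAt a → VanishesAt b → ∀ y → f₂ y F.+ f₃ ((a + b) * y) F.≈ F.0#
    two-points {a} {b} a≉b La≈0 Lb≈0 y =
      F.trans (F.+-cong (f-cong (dot-γ φ₂) y≈zu) (f-cong (dot-take-γ φ₃) (*-congˡ y≈zu))) (begin
        D                                        ≈⟨ F.+-identityˡ D ⟨
        F.0# F.+ D                               ≈⟨ F.+-congʳ (Lb≈0 u) ⟨
        f₁ u F.+ (f₂ (b * u) F.+ f₃ (b * (b * u))) F.+ D ≈⟨ F.+-assoc (f₁ u) _ D ⟩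
        f₁ u F.+ (f₂ (b * u) F.+ f₃ (b * (b * u)) F.+ D) ≈⟨ F.+-congˡ (F.interchange _ _ _ _) ⟩
        f₁ u F.+ (f₂ (b * u) F.+ f₂ (z * u) F.+ (f₃ (b * (b * u)) F.+ f₃ ((a + b) * (z * u))))
          ≈⟨ F.+-congˡ (F.+-cong (f-+ (dot-γ φ₂) _ _) (f-+ (dot-take-γ φ₃) _ _)) ⟨
        f₁ u F.+ (f₂ (b * u + z * u) F.+ f₃ (b * (b * u) + (a + b) * (z * u)))
          ≈⟨ F.+-congˡ (F.+-cong (f-cong (dot-γ φ₂) linear-part) (f-cong (dot-take-γ φ₃) quadratic-part)) ⟩
        f₁ u F.+ (f₂ (a * u) F.+ f₃ (a * (a * u))) ≈⟨ La≈0 u ⟩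
        F.0#                                     ∎)
      where
      open SetoidReasoning F.setoid
      open SemiringSolver commutativeSemiring using (solve; _:+_; _:*_; _:=_)
      open Difference a≉b y
      D = f₂ (z * u) F.+ f₃ ((a + b) * (z * u))
      linear-part : b * u + z * u ≈ a * u
      linear-part = ≈-trans (≈-sym (distribʳ u b z)) (*-congʳ (≈-trans (+-comm b z) z+b≈a))
      quadratic-part : b * (b * u) + (a + b) * (z * u) ≈ a * (a * u)
      quadratic-part = ≈-trans (+-congˡ (*-congʳ (+-congʳ (≈-sym z+b≈a)))) (≈-trans
        (solve 3 (λ b z u → b :* (b :* u) :+ (z :+ b :+ b) :* (z :* u) := (z :+ b) :* ((z :+ b) :* u)) ≈-refl b z u)
        (*-cong z+b≈a (*-congʳ z+b≈a)))

    -- Second divided difference: the results of `two-points` for a, c and for b, c differ at `u` by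
    -- f₃((a - b)u), which is `f₃ y`.
    three-points : ∀ {a b c} → ¬ a ≈ b → ¬ a ≈ c → ¬ b ≈ c →
      VanishesAt a → VanishesAt b → VanishesAt c → ∀ y → f₃ y F.≈ F.0#
    three-points {a} {b} {c} a≉b a≉c b≉c La≈0 Lb≈0 Lc≈0 y = begin
      f₃ y                                        ≈⟨ f-cong (dot-take-γ φ₃) y≈zu ⟩
      f₃ (z * u)                                  ≈⟨ F.+-identityˡ _ ⟨
      F.0# F.+ f₃ (z * u)                         ≈⟨ F.+-congʳ (two-points b≉c Lb≈0 Lc≈0 u) ⟨
      f₂ u F.+ f₃ ((b + c) * u) F.+ f₃ (z * u)    ≈⟨ F.+-assoc _ _ _ ⟩
      f₂ u F.+ (f₃ ((b + c) * u) F.+ f₃ (z * u))  ≈⟨ F.+-congˡ (f-+ (dot-take-γ φ₃) _ _) ⟨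
      f₂ u F.+ f₃ ((b + c) * u + z * u)           ≈⟨ F.+-congˡ (f-cong (dot-take-γ φ₃) sum≈) ⟩
      f₂ u F.+ f₃ ((a + c) * u)                   ≈⟨ two-points a≉c La≈0 Lc≈0 u ⟩
      F.0#                                        ∎
      where
      open SetoidReasoning F.setoid
      open Difference a≉b y
      sum≈ : (b + c) * u + z * u ≈ (a + c) * u
      sum≈ = ≈-trans (≈-sym (distribʳ u (b + c) z)) (*-congʳ (≈-trans (+-comm (b + c) z)
        (≈-trans (≈-sym (+-assoc z b c)) (+-congʳ z+b≈a))))

    φ₃≋0⇒f₃≈0 : φ₃ ≋ 0⃗ → ∀ y → f₃ y F.≈ F.0#
    φ₃≋0⇒f₃≈0 φ₃≋0 y = sum-zero {k} _ (λ i → F.trans (F.*-congʳ (φ₃≋0 i)) (F.zeroˡ _))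

    -- Surjectivity of π: the field element with coordinates `unit i ++ 0⃗` is mapped to `unit i`.
    f₃≈0⇒φ₃≋0 : (∀ y → f₃ y F.≈ F.0#) → φ₃ ≋ 0⃗
    f₃≈0⇒φ₃≋0 f₃≈0 i = F.trans (F.sym (dot-unit φ₃ i)) (F.trans
      (≋-cong (dot-linear φ₃) (λ j → F.sym (F.trans (γ-β (unit i ++ 0⃗) (j ↑ˡ w))
        (F.reflexive (lookup-++ˡ {n = w} (unit i) 0⃗ j)))))
      (f₃≈0 (β (unit i ++ 0⃗))))

    dot-γ≈0⇒≋0 : ∀ (ψ : Vector F.Carrier h) → (∀ y → dot ψ (γ y) F.≈ F.0#) → ψ ≋ 0⃗
    dot-γ≈0⇒≋0 ψ ψγ≈0 i = F.trans (F.sym (dot-unit ψ i)) (F.trans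
      (≋-cong (dot-linear ψ) (≋-sym (γ-β (unit i)))) (ψγ≈0 (β (unit i))))

    f₂≈f₃≈0⇒φ≋0 : ∀ a → VanishesAt a → (∀ y → f₂ y F.≈ F.0#) → (∀ y → f₃ y F.≈ F.0#) → φ ≋ 0⃗
    f₂≈f₃≈0⇒φ≋0 a La≈0 f₂≈0 f₃≈0 = take-drop-zero h φ
      (dot-γ≈0⇒≋0 φ₁ λ y → F.trans (F.sym (F.trans
        (F.+-congˡ (F.trans (F.+-cong (f₂≈0 (a * y)) (f₃≈0 (a * (a * y)))) (F.+-identityˡ F.0#)))
        (F.+-identityʳ (f₁ y)))) (La≈0 y))
      (take-drop-zero h (drop h φ) (dot-γ≈0⇒≋0 φ₂ f₂≈0) (f₃≈0⇒φ₃≋0 f₃≈0))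

    two-points+f₃≈0⇒φ≋0 : ∀ {a b} → ¬ a ≈ b → VanishesAt a → VanishesAt b → (∀ y → f₃ y F.≈ F.0#) → φ ≋ 0⃗
    two-points+f₃≈0⇒φ≋0 {a} {b} a≉b La≈0 Lb≈0 f₃≈0 = f₂≈f₃≈0⇒φ≋0 a La≈0
      (λ y → F.trans (F.sym (F.trans (F.+-congˡ (f₃≈0 ((a + b) * y))) (F.+-identityʳ (f₂ y))))
             (two-points a≉b La≈0 Lb≈0 y))
      f₃≈0

    kills-V₁ : Kills φ V₁ → drop k φ₂ ≋ 0⃗ × φ₃ ≋ 0⃗
    kills-V₁ φV₁≈0 = let units , third = kills-++ φ _ third-block φV₁≈0 in
      kills-units φ (λ i → h ↑ʳ ((k ↑ʳ i) ↑ˡ k)) units , kills-units φ (λ i → h ↑ʳ (h ↑ʳ i)) third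

    kills-V₂ : Kills φ V₂ → take k φ₂ ≋ 0⃗ × φ₃ ≋ 0⃗
    kills-V₂ φV₂≈0 = let units , third = kills-++ φ _ third-block φV₂≈0 in
      kills-units φ (λ i → h ↑ʳ ((i ↑ˡ w) ↑ˡ k)) units , kills-units φ (λ i → h ↑ʳ (h ↑ʳ i)) third

    -- The two extra members clear complementary halves of `φ₂`, which is T + T′ = K, and both clear
    -- `φ₃`; the point then clears `φ₁`.
    V₁+V₂+point : Kills φ V₁ → Kills φ V₂ → ∀ a → Kills φ (point a) → φ ≋ 0⃗
    V₁+V₂+point φV₁≈0 φV₂≈0 a φa≈0 = f₂≈f₃≈0⇒φ≋0 a (kills-point a φa≈0)
      (λ y → sum-zero {h} _ (λ i → F.trans (F.*-congʳ (φ₂≋0 i)) (F.zeroˡ _)))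
      (φ₃≋0⇒f₃≈0 (proj₂ (kills-V₁ φV₁≈0)))
      where φ₂≋0 = take-drop-zero k φ₂ (proj₁ (kills-V₂ φV₂≈0)) (proj₁ (kills-V₁ φV₁≈0))

    V₁+two-points : Kills φ V₁ → ∀ {a b} → ¬ a ≈ b → Kills φ (point a) → Kills φ (point b) → φ ≋ 0⃗
    V₁+two-points φV₁≈0 a≉b φa≈0 φb≈0 = two-points+f₃≈0⇒φ≋0 a≉b (kills-point _ φa≈0) (kills-point _ φb≈0)
      (φ₃≋0⇒f₃≈0 (proj₂ (kills-V₁ φV₁≈0)))

    V₂+two-points : Kills φ V₂ → ∀ {a b} → ¬ a ≈ b → Kills φ (point a) → Kills φ (point b) → φ ≋ 0⃗
    V₂+two-points φV₂≈0 a≉b φa≈0 φb≈0 = two-points+f₃≈0⇒φ≋0 a≉b (kills-point _ φa≈0) (kills-point _ φb≈0)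
      (φ₃≋0⇒f₃≈0 (proj₂ (kills-V₂ φV₂≈0)))

    points : ∀ {a b c} → ¬ a ≈ b → ¬ a ≈ c → ¬ b ≈ c →
      Kills φ (point a) → Kills φ (point b) → Kills φ (point c) → φ ≋ 0⃗
    points a≉b a≉c b≉c φa≈0 φb≈0 φc≈0 = two-points+f₃≈0⇒φ≋0 a≉b La≈0 Lb≈0
      (three-points a≉b a≉c b≉c La≈0 Lb≈0 (kills-point _ φc≈0))
      where
      La≈0 = kills-point _ φa≈0
      Lb≈0 = kills-point _ φb≈0

  vectors = finite-power F.setoid order h
  open Inverse vectors using (from; to-cong; strictlyInverseˡ)

  element : Fin (q ℕ.^ h) → Carrier
  element = β ∘ from

  element-distinct : ∀ {i j} → i < j → ¬ element i ≈ element j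
  element-distinct {i} {j} i<j eq = ℕ.<⇒≢ i<j (cong toℕ
    (trans (sym (strictlyInverseˡ i)) (trans (to-cong (β-inj eq)) (strictlyInverseˡ j))))

  w+k≤h = ℕ.≤-reflexive (ℕ.+-comm w k)
  k+k≤h = ℕ.+-monoʳ-≤ k k≤w

  family : Vector (Family h) (2 ℕ.+ q ℕ.^ h)
  family zero          = pad w+k≤h V₁
  family (suc zero)    = pad k+k≤h V₂
  family (suc (suc i)) = point (element i)

  -- With the two extra members first, an increasing triple is of one of four types; the last four
  -- clauses contradict the order.
  family-isArc : IsArc family
  family-isArc φ φ≉0 zero (suc zero) (suc (suc l)) _ _ (φV₁ , φV₂ , φl) =
    φ≉0 (V₁+V₂+point φ (kills-pad w+k≤h φ V₁ φV₁) (kills-pad k+k≤h φ V₂ φV₂) (element l) φl)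
  family-isArc φ φ≉0 zero (suc (suc j)) (suc (suc l)) _ (s≤s (s≤s j<l)) (φV₁ , φj , φl) =
    φ≉0 (V₁+two-points φ (kills-pad w+k≤h φ V₁ φV₁) (element-distinct j<l) φj φl)
  family-isArc φ φ≉0 (suc zero) (suc (suc j)) (suc (suc l)) _ (s≤s (s≤s j<l)) (φV₂ , φj , φl) =
    φ≉0 (V₂+two-points φ (kills-pad k+k≤h φ V₂ φV₂) (element-distinct j<l) φj φl)
  family-isArc φ φ≉0 (suc (suc i)) (suc (suc j)) (suc (suc l)) (s≤s (s≤s i<j)) (s≤s (s≤s j<l)) (φi , φj , φl) =
    φ≉0 (points φ (element-distinct i<j) (element-distinct (ℕ.<-trans i<j j<l)) (element-distinct j<l) φi φj φl)
  family-isArc φ φ≉0 zero (suc zero) (suc zero) _ (s≤s ()) _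
  family-isArc φ φ≉0 (suc zero) (suc zero) _ (s≤s ()) _ _
  family-isArc φ φ≉0 (suc (suc _)) (suc zero) _ (s≤s ()) _ _
  family-isArc φ φ≉0 _ (suc (suc _)) (suc zero) _ (s≤s ()) _

-- The bound for every h at least 2

open import Data.Nat.Base using (_+_; _*_; _^_)

maximum-for : ∀ {c ℓ₁ ℓ₂} {q p n} → Prime p → q ≡ p ^ n → (F : HeytingField c ℓ₁ ℓ₂) → HasOrder F q →
  ∀ k w → 1 ≤ k → k ≤ w → let h = k + w in
  ∃[ N ] IsMaxSize F (h + (h + k)) h 2 N × q ^ h + 2 ≤ N
maximum-for {q = q} {n = n} pr q≡p^n F order k w 1≤k k≤w =
  let N , isMax , 2+q^h≤N = Arcs.arc⇒maximum F order (h + (h + k)) h h+h<r (s≤s (s≤s z≤n)) (family , family-isArc)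
  in N , isMax , ℕ.≤-trans (ℕ.≤-reflexive (ℕ.+-comm (q ^ h) 2)) 2+q^h≤N
  where
  h = k + w
  h+h<r : h + h ℕ.< h + (h + k)
  h+h<r = ℕ.+-monoʳ-< h (ℕ.m<m+n h 1≤k)
  extension = field-extension (LinearAlgebra.F F order) (LinearAlgebra.F-isField F order) order {k = n} pr q≡p^n
    h (ℕ.+-mono-≤ 1≤k (ℕ.≤-trans 1≤k k≤w))
  open Construction F order k w k≤w extension using (family; family-isArc)

-- The even part 4h of 5h is halved exactly, which leaves the rounding to `h / 2`.
5h/2≡ : ∀ h → 5 * h / 2 ≡ h + (h + h / 2)
5h/2≡ h = begin
  5 * h / 2               ≡⟨ cong (_/ 2) 5h≡ ⟩
  (h + 2 * h * 2) / 2     ≡⟨ +-distrib-/-∣ʳ h (n∣m*n (2 * h)) ⟩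
  h / 2 + 2 * h * 2 / 2   ≡⟨ cong (h / 2 +_) (m*n/n≡m (2 * h) 2) ⟩
  h / 2 + 2 * h           ≡⟨ ℕ.+-comm (h / 2) (2 * h) ⟩
  h + (h + 0) + h / 2     ≡⟨ cong (λ l → h + l + h / 2) (ℕ.+-identityʳ h) ⟩
  h + h + h / 2           ≡⟨ ℕ.+-assoc h h (h / 2) ⟩
  h + (h + h / 2)         ∎
  where
  open ≡-Reasoning
  5h≡ : 5 * h ≡ h + 2 * h * 2
  5h≡ = cong (h +_) (trans (ℕ.*-distribʳ-+ h 2 2) (trans
    (cong (2 * h +_) (sym (ℕ.+-identityʳ (2 * h)))) (ℕ.*-comm 2 (2 * h))))

proposition2 : ∀ {c ℓ₁ ℓ₂ : Level} (q : ℕ) → IsPrimePower q →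
    (F : HeytingField c ℓ₁ ℓ₂) → HasOrder F q →
    (h : ℕ) → 2 ≤ h →
    ∃[ N ] IsMaxSize F (5 * h / 2) h 2 N × q ^ h + 2 ≤ N
proposition2 q (p , n , pr , _ , q≡p^n) F order h 2≤h =
  subst (λ r → ∃[ N ] IsMaxSize F r h 2 N × q ^ h + 2 ≤ N) (sym (5h/2≡ h))
    (subst (λ l → ∃[ N ] IsMaxSize F (l + (l + k)) l 2 N × q ^ l + 2 ≤ N) k+w≡h
      (maximum-for {n = n} pr q≡p^n F order k (h ∸ k) (/-monoˡ-≤ 2 2≤h) k≤w))
  where
  -- The other part `h ∸ k` is ⌈h/2⌉, so `k ≤ h ∸ k`; and `h ≥ 2` makes `k` positive, whence 2h <
  -- ⌊5h/2⌋.
  k = h / 2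
  k*2≡k+k : k * 2 ≡ k + k
  k*2≡k+k = trans (ℕ.*-comm k 2) (cong (k +_) (ℕ.+-identityʳ k))
  k+k≤h : k + k ≤ h
  k+k≤h = ℕ.≤-trans (ℕ.≤-reflexive (sym k*2≡k+k)) (m/n*n≤m h 2)
  k+w≡h : k + (h ∸ k) ≡ h
  k+w≡h = ℕ.m+[n∸m]≡n (ℕ.≤-trans (ℕ.m≤m+n k k) k+k≤h)
  k≤w : k ≤ h ∸ k
  k≤w = ℕ.m+n≤o⇒m≤o∸n k k+k≤h
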